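{- Let $G$ be a $2r$-regular graph of order $p$ with $r\ge 1$, $p\ge 3$, $p-2r\ge 2$ and $\chi(G)=\chi_{la}(G)$. Let $G_0=G$ and $G_{k+1}=G_k\vee O_{p-2r}$ for $k\ge 0$. Then $G_{k+1}$ is a $(2r+(k+1)(p-2r))$-regular graph of order $p+(k+1)(p-2r)$, and $\chi_{la}(G_k)=\chi_{la}(G)+k$ for all $k\ge 0$.
   Context: $O_n$ denotes the graph on $n$ vertices with no edges. For vertex-disjoint graphs $G,H$, the join $G\vee H$ has vertex set $V(G)\cup V(H)$ and edge set $E(G)\cup E(H)\cup\{uv: u\in V(G), v\in V(H)\}$; each $O_{p-2r}$ in the iteration is a fresh vertex-disjoint copy. $\chi$ is the chromatic number. For a simple graph with $q$ edges, a bijection $f:E\to\{1,\dots,q\}$ is a local antimagic labeling if $f^+(u)\neq f^+(v)$ for every edge $uv$, where $f^+(u)=\sum_{e\ni u} f(e)$; $\chi_{la}$ is the minimum number of distinct values of $f^+$ over all local antimagic labelings. -}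

module Defs where

open import Data.Nat using (ℕ; zero; suc; _+_; _*_; _≤_; _<ᵇ_)
import Data.Nat as ℕ
open import Data.Bool using (Bool; true; false; if_then_else_; _∧_; _∨_)
open import Data.Fin using (Fin; toℕ; splitAt)
import Data.Fin as F
open import Data.Sum using (_⊎_; inj₁; inj₂)
open import Data.Product using (_×_; _,_; proj₁; proj₂; ∃-syntax)
open import Data.List using (List; []; _∷_; [_]; length; map; concatMap; lookup; allFin; deduplicate)
open import Data.Nat.ListAction using (sum)
open import Relation.Nullary.Decidable using (does)
open import Relation.Binary.PropositionalEquality using (_≡_; _≢_; refl)
open import Function.Bundles using (_↔_; Inverse)

record Graph (n : ℕ) : Set where
  field
    adj    : Fin n → Fin n → Bool
    sym    : ∀ i j → adj i j ≡ adj j i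
    irrefl : ∀ i → adj i i ≡ false
open Graph public

degree : ∀ {n} → Graph n → Fin n → ℕ
degree {n} G u = sum (map (λ v → if adj G u v then 1 else 0) (allFin n))

Regular : ∀ {n} → ℕ → Graph n → Set
Regular {n} d G = ∀ (u : Fin n) → degree G u ≡ d

O : (m : ℕ) → Graph m
O m = record { adj = λ _ _ → false ; sym = λ _ _ → refl ; irrefl = λ _ → refl }

joinAdj : ∀ {n m} → (Fin n → Fin n → Bool) → (Fin m → Fin m → Bool)
        → Fin n ⊎ Fin m → Fin n ⊎ Fin m → Bool
joinAdj a b (inj₁ i) (inj₁ j) = a i j
joinAdj a b (inj₂ i) (inj₂ j) = b i j
joinAdj a b (inj₁ _) (inj₂ _) = true
joinAdj a b (inj₂ _) (inj₁ _) = true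

joinAdj-sym : ∀ {n m} (G : Graph n) (H : Graph m) x y
            → joinAdj (adj G) (adj H) x y ≡ joinAdj (adj G) (adj H) y x
joinAdj-sym G H (inj₁ i) (inj₁ j) = sym G i j
joinAdj-sym G H (inj₂ i) (inj₂ j) = sym H i j
joinAdj-sym G H (inj₁ _) (inj₂ _) = refl
joinAdj-sym G H (inj₂ _) (inj₁ _) = refl

joinAdj-irr : ∀ {n m} (G : Graph n) (H : Graph m) x
            → joinAdj (adj G) (adj H) x x ≡ false
joinAdj-irr G H (inj₁ i) = irrefl G i
joinAdj-irr G H (inj₂ i) = irrefl H i

_∨G_ : ∀ {n m} → Graph n → Graph m → Graph (n + m)
_∨G_ {n} {m} G H = record
  { adj    = λ i j → joinAdj (adj G) (adj H) (splitAt n i) (splitAt n j)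
  ; sym    = λ i j → joinAdj-sym G H (splitAt n i) (splitAt n j)
  ; irrefl = λ i → joinAdj-irr G H (splitAt n i)
  }

iterOrder : ℕ → ℕ → ℕ → ℕ
iterOrder n s zero    = n
iterOrder n s (suc k) = iterOrder n s k + s

iterJoin : ∀ {n} (s : ℕ) → Graph n → (k : ℕ) → Graph (iterOrder n s k)
iterJoin s G zero    = G
iterJoin s G (suc k) = iterJoin s G k ∨G O s

ProperColoring : ∀ {n} → Graph n → (k : ℕ) → (Fin n → Fin k) → Set
ProperColoring {n} G k c = ∀ (u v : Fin n) → adj G u v ≡ true → c u ≢ c v

IsChromaticNumber : ∀ {n} → Graph n → ℕ → Set
IsChromaticNumber {n} G k =
  (∃[ c ] ProperColoring G k c) ×
  (∀ (m : ℕ) (c : Fin n → Fin m) → ProperColoring G m c → k ≤ m)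

edges : ∀ {n} → Graph n → List (Fin n × Fin n)
edges {n} G = concatMap (λ i → concatMap (λ j →
    if adj G i j ∧ (toℕ i <ᵇ toℕ j) then [ (i , j) ] else [])
  (allFin n)) (allFin n)

numEdges : ∀ {n} → Graph n → ℕ
numEdges G = length (edges G)

-- an edge labeling: a bijection E → {1,…,q}; edge e (index into `edges G`)
-- gets label 1 + toℕ (to f e)
EdgeLabeling : ∀ {n} → Graph n → Set
EdgeLabeling G = Fin (numEdges G) ↔ Fin (numEdges G)

label : ∀ {n} (G : Graph n) → EdgeLabeling G → Fin (numEdges G) → ℕ
label G f e = suc (toℕ (Inverse.to f e))

incident : ∀ {n} → Fin n → Fin n × Fin n → Bool
incident u (a , b) = does (u F.≟ a) ∨ does (u F.≟ b)

vsum : ∀ {n} (G : Graph n) → EdgeLabeling G → Fin n → ℕ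
vsum G f u = sum (map (λ e → if incident u (lookup (edges G) e) then label G f e else 0)
                      (allFin (numEdges G)))

IsLocalAntimagic : ∀ {n} (G : Graph n) → EdgeLabeling G → Set
IsLocalAntimagic {n} G f = ∀ (u v : Fin n) → adj G u v ≡ true → vsum G f u ≢ vsum G f v

numColors : ∀ {n} (G : Graph n) → EdgeLabeling G → ℕ
numColors {n} G f = length (deduplicate ℕ._≟_ (map (vsum G f) (allFin n)))

IsLocalAntimagicChromaticNumber : ∀ {n} → Graph n → ℕ → Set
IsLocalAntimagicChromaticNumber G c =
  (∃[ f ] (IsLocalAntimagic G f × numColors G f ≡ c)) ×
  (∀ (f : EdgeLabeling G) → IsLocalAntimagic G f → c ≤ numColors G f)

{-# OPTIONS --safe #-}
module Submission where

-- Write s = p - 2r; every G_k has order minus degree equal to s.  A colouring of G_{k+1}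
-- restricts to a colouring of G_k that avoids the colour of a new vertex, so G_k needs at
-- least c + k colours.  Conversely, let H be one of the graphs, with n vertices and q edges,
-- and label the n s new edges of H v O_s by q plus the entries of an n x s magic rectangle.
-- All old weights grow by the same amount, and all new vertices get one common weight, which
-- is larger because s < n.  This needs n = s mod 2, which fails for odd s and odd k; then two
-- joins are labelled at once, by two copies of an n x s magic rectangle and a magic s x s square.
--
-- Magic rectangles are built from centred entries, so that all row and column sums vanish.
-- For even sides, 2 x 4 tiles and their transposes suffice, together with one 6 x 2 tile.  For
-- odd sides s = 2S + 1 >= 5 and s + 2r, a Graeco-Latin square is extended by r pairs of
-- opposite rows: the square uses [-S, S] and S intervals of length s (up to sign) that can be
-- placed freely, and each row consists of x + y - z and S - 1 differences of consecutive
-- numbers.  For s = 3, the columns come in centrally symmetric pairs, one for each triple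
-- x + y = z of a Skolem-type partition of an interval minus one point.

open import Defs
open import Data.Nat using (ℕ; zero; suc; _+_; _*_; _∸_; _≤_; _<_; _<ᵇ_; z≤n; s≤s; >-nonZero)
open import Data.Nat.Properties
open import Data.Nat.DivMod using (_%_; _/_; _mod_; m≡m%n+[m/n]*n; %-distribˡ-+; m%n%n≡m%n)
open import Data.Nat.Divisibility using (_∣_; divides; ∣m+n∣m⇒∣n; n∣m*n)
open import Data.Nat.ListAction using (sum)
open import Data.Nat.ListAction.Properties using (sum-++; sum-↭)
import Data.Nat.Tactic.RingSolver as ℕ-Solver
open import Data.Bool using (true; false; if_then_else_; _∧_; _∨_; T)
open import Data.Bool.Properties using (∨-identityʳ)
open import Data.Fin using (Fin; zero; suc; toℕ; fromℕ<; _↑ˡ_; _↑ʳ_; splitAt; punchOut; #_)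
import Data.Fin as F
open import Data.Fin.Properties as F using (splitAt-↑ˡ; splitAt-↑ʳ; splitAt⁻¹-↑ˡ; splitAt⁻¹-↑ʳ; toℕ-↑ˡ; toℕ-↑ʳ; toℕ<n; toℕ-fromℕ<; toℕ-injective; ↑ˡ-injective; punchOut-injective)
open import Data.Product using (_×_; _,_; proj₁; proj₂; ∃-syntax; Σ-syntax)
open import Data.Sum using (_⊎_; inj₁; inj₂; [_,_]′)
open import Data.Vec as Vec using (Vec; []; _∷_)
open import Data.Vec.Relation.Unary.All using ([]; _∷_) renaming (All to VAll)
import Data.Vec.Relation.Unary.All.Properties as VAll
open import Data.List using (List; []; _∷_; [_]; _++_; length; map; concat; concatMap; tabulate; allFin; lookup; foldr; take; deduplicate)
open import Data.List.Properties as List using (tabulate-cong; tabulate-lookup; map-tabulate; length-tabulate; length-map; map-++; map-∘; map-cong; map-id; concat-++; concat-map)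
open import Data.List.Membership.Propositional using (_∈_)
open import Data.List.Membership.Propositional.Properties using (∈-∃++; ∈-++⁻; ∈-++⁺ˡ; ∈-++⁺ʳ; ∈-tabulate⁺; ∈-tabulate⁻; ∈-allFin; ∈-map⁺; ∈-map⁻; ∈-deduplicate⁺; ∈-deduplicate⁻)
open import Data.List.Membership.DecPropositional _≟_ using (_∈?_)
open import Data.List.Relation.Unary.Any using (here; there; index)
open import Data.List.Relation.Unary.Any.Properties using (lookup-index)
open import Data.List.Relation.Unary.All as All using (All; []; _∷_)
import Data.List.Relation.Unary.All.Properties as All
open import Data.List.Relation.Unary.AllPairs using ([]; _∷_)
open import Data.List.Relation.Unary.Unique.Propositional using (Unique)
import Data.List.Relation.Unary.Unique.Propositional.Properties as Uniq
open import Data.List.Relation.Unary.Unique.DecPropositional using (unique?)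
open import Data.List.Relation.Unary.Unique.DecPropositional.Properties _≟_ using (deduplicate-!)
open import Data.List.Relation.Binary.Subset.Propositional using (_⊆_)
open import Data.List.Relation.Binary.Permutation.Propositional
open import Data.List.Relation.Binary.Permutation.Propositional.Properties as Perm using (map⁺; ++⁺; ++⁺ˡ; ++⁺ʳ; shift; shifts; ++-comm; ++-commutativeMonoid; ∷↭∷ʳ; ↭-length; ↭-map-inv; ∈-resp-↭)
open import Algebra.Properties.CommutativeSemigroup +-commutativeSemigroup using () renaming (interchange to +-interchange)
import Algebra.Solver.CommutativeMonoid as CommutativeMonoidSolver
open import Function using (_∘_; id; flip; const)
open import Function.Bundles using (_↔_; Inverse; Injection; mk↔ₛ′)
open import Function.Definitions using (Injective)
open import Function.Properties.Inverse using (Inverse⇒Injection)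
open import Relation.Binary.PropositionalEquality as ≡ using (_≡_; _≢_; refl; cong; cong₂; subst)
open import Relation.Nullary using (contradiction; does; yes; no)
open import Relation.Nullary.Decidable using (True; toWitness; dec-true; dec-false)

-- The parity condition is genuine: each row of an `n` x `s` magic rectangle sums to `s(ns+1)/2`,
-- not an integer for even `n` and odd `s`. Treating two joins at once gains freedom: in the second
-- join the old vertices and the first copy of `O s` may have different row sums, since they carry
-- different colours anyway. Hence a rectangle stacked on a square is enough.
--
-- The two bounds speak about different numbers: the lower one holds for every proper colouring, the
-- upper one grows from an optimal labelling of `G`. They meet because of `χ(G) = χ_la(G)`.
--
-- For odd sides at least 5, signs are arranged so that every line cancels, and what remains is a
-- partition of an initial segment of the positive integers into intervals, triples and pairs of
-- neighbours. In nested pairs the difference `z - y` moves in steps of two, so one nest serves only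
-- `x`s of one parity. Two nests with gaps of different parity are needed; an interval of the square
-- (odd length) and unit pairs (even length) fill them. For `s = 3` there are no unit pairs, which
-- is why that case has its own construction.

private variable
  A B : Set
  n : ℕ

module ++-Solver = CommutativeMonoidSolver (++-commutativeMonoid {A = ℕ})

-- Lists

⊆-remove : ∀ {x : A} {xs} as {bs} → All (x ≢_) xs → xs ⊆ as ++ x ∷ bs → xs ⊆ as ++ bs
⊆-remove as x∉xs xs⊆ y∈xs with ∈-++⁻ as (xs⊆ y∈xs)
... | inj₁ y∈as         = ∈-++⁺ˡ y∈as
... | inj₂ (here refl)  = contradiction refl (All.lookup x∉xs y∈xs)
... | inj₂ (there y∈bs) = ∈-++⁺ʳ as y∈bs

unique-⊆⇒length≤ : ∀ {xs ys : List A} → Unique xs → xs ⊆ ys → length xs ≤ length ys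
unique-⊆⇒length≤ []              xs⊆ys = z≤n
unique-⊆⇒length≤ (x∉xs ∷ xs!) xs⊆ys with ∈-∃++ (xs⊆ys (here refl))
... | as , bs , refl = subst (suc _ ≤_) (≡.sym (↭-length (shift _ as bs)))
  (s≤s (unique-⊆⇒length≤ xs! (⊆-remove as x∉xs (xs⊆ys ∘ there))))

-- Pigeonhole principle for lists. The surjectivity of injective self-maps of `Fin n` and all
-- permutations checked by decision rest on it.
unique-⊆⇒↭ : ∀ {xs ys : List A} → Unique xs → xs ⊆ ys → length ys ≤ length xs → xs ↭ ys
unique-⊆⇒↭ {ys = []} [] xs⊆ys ys≤xs = ↭-refl
unique-⊆⇒↭ (x∉xs ∷ xs!) xs⊆ys ys≤xs with ∈-∃++ (xs⊆ys (here refl))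
... | as , bs , refl = ↭-trans
  (prep _ (unique-⊆⇒↭ xs! (⊆-remove as x∉xs (xs⊆ys ∘ there))
            (≤-pred (subst (_≤ _) (↭-length (shift _ as bs)) ys≤xs))))
  (↭-sym (shift _ as bs))

tabulate-+ : ∀ m {n} (f : Fin (m + n) → A) →
             tabulate f ≡ tabulate (f ∘ (_↑ˡ n)) ++ tabulate (f ∘ (m ↑ʳ_))
tabulate-+ zero    f = refl
tabulate-+ (suc m) f = cong (f zero ∷_) (tabulate-+ m (f ∘ suc))

tabulate-∘-injective : ∀ {n} {f : Fin n → Fin n} (g : Fin n → A) → Injective _≡_ _≡_ f →
                       tabulate (g ∘ f) ↭ tabulate g
tabulate-∘-injective {n = n} {f} g inj =
  ≡.subst₂ _↭_ (map-tabulate f g) (map-tabulate id g)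
    (map⁺ g (unique-⊆⇒↭ (Uniq.tabulate⁺ inj) (λ {i} _ → ∈-allFin i)
       (≤-reflexive (≡.trans (length-tabulate {n = n} id) (≡.sym (length-tabulate f))))))

concat-tabulate-↭ : ∀ {n} {f g : Fin n → List A} → (∀ i → f i ↭ g i) →
                    concat (tabulate f) ↭ concat (tabulate g)
concat-tabulate-↭ {n = zero}  p = ↭-refl
concat-tabulate-↭ {n = suc n} p = ++⁺ (p zero) (concat-tabulate-↭ (p ∘ suc))

interchange : ∀ (as bs {cs ds} : List A) → (as ++ bs) ++ (cs ++ ds) ↭ (as ++ cs) ++ (bs ++ ds)
interchange as bs {cs} {ds} = begin
  (as ++ bs) ++ (cs ++ ds) ↭⟨ Perm.++-assoc as bs _ ⟩
  as ++ bs ++ cs ++ ds     ↭⟨ ++⁺ˡ as (shifts bs cs) ⟩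
  as ++ cs ++ bs ++ ds     ↭⟨ Perm.++-assoc as cs _ ⟨
  (as ++ cs) ++ (bs ++ ds) ∎
  where open PermutationReasoning

concat-tabulate-++ : ∀ {n} (f g : Fin n → List A) →
  concat (tabulate (λ i → f i ++ g i)) ↭ concat (tabulate f) ++ concat (tabulate g)
concat-tabulate-++ {n = zero}  f g = ↭-refl
concat-tabulate-++ {n = suc n} f g =
  ↭-trans (++⁺ˡ (f zero ++ g zero) (concat-tabulate-++ (f ∘ suc) (g ∘ suc)))
          (interchange (f zero) (g zero))

concat-singletons : ∀ {n} (f : Fin n → A) → concat (tabulate ([_] ∘ f)) ≡ tabulate f
concat-singletons {n = zero}  f = refl
concat-singletons {n = suc n} f = cong (f zero ∷_) (concat-singletons (f ∘ suc))

concat-[] : ∀ n → concat (tabulate {n = n} (λ _ → [])) ≡ ([] {A = A})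
concat-[] zero    = refl
concat-[] (suc n) = concat-[] n

entries : ∀ {a b} → (Fin a → Fin b → A) → List A
entries M = concat (tabulate (λ i → tabulate (M i)))

entries-flip : ∀ {a b} (M : Fin a → Fin b → A) → entries (flip M) ↭ entries M
entries-flip {a = a} {zero}  M = ↭-reflexive (≡.sym (concat-[] a))
entries-flip {a = a} {suc b} M = ↭-trans
  (++⁺ (↭-reflexive (≡.sym (concat-singletons (λ i → M i zero)))) (entries-flip (λ i j → M i (suc j))))
  (↭-sym (concat-tabulate-++ (λ i → [ M i zero ]) (λ i → tabulate (λ j → M i (suc j)))))

map-entries : ∀ {a b} (f : A → B) (M : Fin a → Fin b → A) →
              map f (entries M) ≡ entries (λ i j → f (M i j))
map-entries {a = zero}  f M = refl
map-entries {a = suc a} f M = ≡.trans (map-++ f (tabulate (M zero)) _)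
  (cong₂ _++_ (map-tabulate (M zero) f) (map-entries f (M ∘ suc)))

∈-entries : ∀ {a b} (M : Fin a → Fin b → A) i j → M i j ∈ entries M
∈-entries M zero    j = ∈-++⁺ˡ (∈-tabulate⁺ j)
∈-entries M (suc i) j = ∈-++⁺ʳ (tabulate (M zero)) (∈-entries (M ∘ suc) i j)

rng : ℕ → ℕ → List ℕ
rng x zero    = []
rng x (suc n) = x ∷ rng (suc x) n

rng-++ : ∀ x m n → rng x (m + n) ≡ rng x m ++ rng (m + x) n
rng-++ x zero    n = refl
rng-++ x (suc m) n = cong (x ∷_) (≡.trans (rng-++ (suc x) m n)
  (cong (λ y → rng (suc x) m ++ rng y n) (+-suc m x)))

length-rng : ∀ x n → length (rng x n) ≡ n
length-rng x zero    = refl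
length-rng x (suc n) = cong suc (length-rng (suc x) n)

rng-bound : ∀ x n → All (λ y → x ≤ y × y < n + x) (rng x n)
rng-bound x zero    = []
rng-bound x (suc n) = (≤-refl , s≤s (m≤n+m x n)) ∷
  All.map (λ {y} (p , q) → ≤-trans (n≤1+n x) p , subst (y <_) (+-suc n x) q) (rng-bound (suc x) n)

∑ : ∀ {n} → (Fin n → ℕ) → ℕ
∑ f = sum (tabulate f)

∑-cong : ∀ {n} {f g : Fin n → ℕ} → (∀ i → f i ≡ g i) → ∑ f ≡ ∑ g
∑-cong p = cong sum (tabulate-cong p)

∑-const : ∀ n k → ∑ {n} (λ _ → k) ≡ n * k
∑-const zero    k = refl
∑-const (suc n) k = cong (k +_) (∑-const n k)

∑-↑ : ∀ m {n} (f : Fin (m + n) → ℕ) → ∑ f ≡ ∑ (f ∘ (_↑ˡ n)) + ∑ (f ∘ (m ↑ʳ_))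
∑-↑ m {n} f = ≡.trans (cong sum (tabulate-+ m f)) (sum-++ (tabulate (f ∘ (_↑ˡ n))) _)

∑-+ : ∀ {n} (f g : Fin n → ℕ) → ∑ (λ i → f i + g i) ≡ ∑ f + ∑ g
∑-+ {zero}  f g = refl
∑-+ {suc n} f g = ≡.trans (cong (f zero + g zero +_) (∑-+ (f ∘ suc) (g ∘ suc)))
  (+-interchange (f zero) (g zero) _ _)

∑-mono : ∀ {n} {f g : Fin n → ℕ} → (∀ i → f i ≤ g i) → ∑ f ≤ ∑ g
∑-mono {zero}  p = z≤n
∑-mono {suc n} p = +-mono-≤ (p zero) (∑-mono (p ∘ suc))

sum-entries : ∀ {a b} (M : Fin a → Fin b → ℕ) → sum (entries M) ≡ ∑ (λ i → ∑ (M i))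
sum-entries {zero}  M = refl
sum-entries {suc a} M = ≡.trans (sum-++ (tabulate (M zero)) _) (cong (∑ (M zero) +_) (sum-entries (M ∘ suc)))

-- The permutation is checked on the indices, so the entries of xs may be symbolic.
select-↭ : (xs : List A) (is : List (Fin (length xs))) →
           {True (unique? F._≟_ is)} → {True (length xs ≟ length is)} → map (lookup xs) is ↭ xs
select-↭ xs is {is!} {len} = ↭-trans
  (map⁺ (lookup xs) (unique-⊆⇒↭ (toWitness is!) (λ {i} _ → ∈-allFin i)
     (≤-reflexive (≡.trans (length-tabulate {n = length xs} id) (toWitness len)))))
  (↭-reflexive (≡.trans (map-tabulate id (lookup xs)) (tabulate-lookup xs)))

-- Magic rectangles

record Magic (a b : ℕ) : Set where
  field
    matrix : Fin a → Fin b → ℕ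
    ρ κ    : ℕ
    rows   : ∀ i → ∑ (matrix i) ≡ ρ
    cols   : ∀ j → ∑ (λ i → matrix i j) ≡ κ
    ents   : entries matrix ↭ rng 1 (a * b)

Magic-flip : ∀ {a b} → Magic a b → Magic b a
Magic-flip {a} {b} X = record
  { matrix = flip matrix
  ; rows   = cols
  ; cols   = rows
  ; ents   = ↭-trans (entries-flip matrix) (↭-trans ents (↭-reflexive (cong (rng 1) (*-comm a b))))
  } where open Magic X

-- Sums over edges

cell : (G : Graph n) → Fin n → Fin n → List (Fin n × Fin n)
cell G i j = if adj G i j ∧ (toℕ i <ᵇ toℕ j) then [ (i , j) ] else []

concatMap-allFin : ∀ {n} (f : Fin n → List A) → concatMap f (allFin n) ≡ concat (tabulate f)
concatMap-allFin f = cong concat (map-tabulate id f)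

edges-cells : (G : Graph n) → edges G ≡ concat (tabulate λ i → concat (tabulate (cell G i)))
edges-cells G = ≡.trans (concatMap-allFin (λ i → concatMap (cell G i) (allFin _)))
  (cong concat (tabulate-cong (λ i → concatMap-allFin (cell G i))))

sum-map-concat-tabulate : ∀ (g : A → ℕ) {n} (f : Fin n → List A) →
                          sum (map g (concat (tabulate f))) ≡ ∑ (λ i → sum (map g (f i)))
sum-map-concat-tabulate g {zero}  f = refl
sum-map-concat-tabulate g {suc n} f = begin
  sum (map g (f zero ++ rest))              ≡⟨ cong sum (map-++ g (f zero) rest) ⟩
  sum (map g (f zero) ++ map g rest)        ≡⟨ sum-++ (map g (f zero)) _ ⟩
  sum (map g (f zero)) + sum (map g rest)   ≡⟨ cong (sum (map g (f zero)) +_) (sum-map-concat-tabulate g (f ∘ suc)) ⟩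
  ∑ (λ i → sum (map g (f i)))               ∎
  where
  open ≡.≡-Reasoning
  rest = concat (tabulate (f ∘ suc))

sum-edges : (G : Graph n) (g : Fin n × Fin n → ℕ) →
            sum (map g (edges G)) ≡ ∑ (λ i → ∑ (λ j → sum (map g (cell G i j))))
sum-edges G g = ≡.trans (cong (sum ∘ map g) (edges-cells G))
  (≡.trans (sum-map-concat-tabulate g (λ i → concat (tabulate (cell G i)))) (∑-cong (λ i → sum-map-concat-tabulate g (cell G i))))

δ : Fin n → Fin n → ℕ → ℕ
δ u i x = if does (u F.≟ i) then x else 0

∑-zero : ∀ n → ∑ {n} (λ _ → 0) ≡ 0
∑-zero n = ≡.trans (∑-const n 0) (*-zeroʳ n)

∑-δ : ∀ {n} (u : Fin n) (f : Fin n → ℕ) → ∑ (λ i → δ u i (f i)) ≡ f u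
∑-δ {suc n} zero    f = ≡.trans (cong (f zero +_) (∑-zero n)) (+-identityʳ (f zero))
∑-δ {suc n} (suc u) f = ∑-δ u (f ∘ suc)

∑-swap : ∀ {a b} (M : Fin a → Fin b → ℕ) → ∑ (λ i → ∑ (M i)) ≡ ∑ (λ j → ∑ (λ i → M i j))
∑-swap M = ≡.trans (≡.sym (sum-entries M)) (≡.trans (sum-↭ (↭-sym (entries-flip M))) (sum-entries (λ j i → M i j)))

incidence : Fin n → Fin n × Fin n → ℕ
incidence u e = if incident u e then 1 else 0

-- Each neighbour v of u contributes once, through the cell (u , v) or the cell (v , u).
incidence≤degree : (G : Graph n) (u : Fin n) → sum (map (incidence u) (edges G)) ≤ degree G u
incidence≤degree {n} G u = begin
  sum (map (incidence u) (edges G))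
    ≡⟨ sum-edges G (incidence u) ⟩
  ∑ (λ i → ∑ (λ j → sum (map (incidence u) (cell G i j))))
    ≤⟨ ∑-mono (λ i → ∑-mono (λ j → split i j)) ⟩
  ∑ (λ i → ∑ (λ j → δ u i (count i j) + δ u j (count i j)))
    ≡⟨ ∑-cong (λ i → ∑-+ (λ j → δ u i (count i j)) (λ j → δ u j (count i j))) ⟩
  ∑ (λ i → ∑ (λ j → δ u i (count i j)) + ∑ (λ j → δ u j (count i j)))
    ≡⟨ ∑-+ (λ i → ∑ (λ j → δ u i (count i j))) _ ⟩
  ∑ (λ i → ∑ (λ j → δ u i (count i j))) + ∑ (λ i → ∑ (λ j → δ u j (count i j)))
    ≡⟨ cong₂ _+_ (≡.trans (∑-swap (λ i j → δ u i (count i j))) (∑-cong (λ j → ∑-δ u (λ i → count i j)))) (∑-cong (λ i → ∑-δ u (count i))) ⟩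
  ∑ (count u) + ∑ (λ i → count i u)
    ≡⟨ ∑-+ (count u) (λ i → count i u) ⟨
  ∑ (λ v → count u v + count v u)
    ≤⟨ ∑-mono one-sided ⟩
  ∑ (λ v → if adj G u v then 1 else 0)
    ≡⟨ cong sum (map-tabulate id (λ v → if adj G u v then 1 else 0)) ⟨
  degree G u ∎
  where
  open ≤-Reasoning
  count : Fin n → Fin n → ℕ
  count i j = if adj G i j ∧ (toℕ i <ᵇ toℕ j) then 1 else 0
  split : ∀ i j → sum (map (incidence u) (cell G i j)) ≤ δ u i (count i j) + δ u j (count i j)
  split i j with adj G i j ∧ (toℕ i <ᵇ toℕ j)
  ... | false = z≤n
  ... | true with does (u F.≟ i) | does (u F.≟ j)
  ...   | true  | _     = s≤s z≤n
  ...   | false | true  = ≤-refl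
  ...   | false | false = z≤n
  one-sided : ∀ v → count u v + count v u ≤ (if adj G u v then 1 else 0)
  one-sided v rewrite Graph.sym G v u with adj G u v
  ... | false = z≤n
  ... | true with toℕ u <ᵇ toℕ v in p | toℕ v <ᵇ toℕ u in q
  ...   | true  | true  = contradiction (<ᵇ⇒< (toℕ u) _ (subst T (≡.sym p) _)) (<⇒≯ (<ᵇ⇒< (toℕ v) _ (subst T (≡.sym q) _)))
  ...   | true  | false = ≤-refl
  ...   | false | true  = ≤-refl
  ...   | false | false = z≤n

-- Labellings as lists of labelled edges

weight : List ((Fin n × Fin n) × ℕ) → Fin n → ℕ
weight L u = sum (map (λ (e , l) → if incident u e then l else 0) L)

-- `edges` lists the edges of a join in a new order, so a bijection of positions would have to be
-- transported at every join, whereas a list of labelled edges up to permutation is only appended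
-- to. `size` is a field, not `numEdges G`, so that after a join it is literally `size L + n * s`;
-- `length-list` proves that the two agree.
record Labelling (G : Graph n) : Set where
  field
    size     : ℕ
    list     : List ((Fin n × Fin n) × ℕ)
    edges-↭  : map proj₁ list ↭ edges G
    labels-↭ : map proj₂ list ↭ rng 1 size

open Labelling

tabulate-rng : ∀ x n → tabulate {n = n} (λ i → x + toℕ i) ≡ rng x n
tabulate-rng x zero    = refl
tabulate-rng x (suc n) = cong₂ _∷_ (+-identityʳ x)
  (≡.trans (tabulate-cong (λ i → +-suc x (toℕ i))) (tabulate-rng (suc x) n))

fromEdgeLabeling : (G : Graph n) → EdgeLabeling G → Labelling G
fromEdgeLabeling G f = record
  { size     = numEdges G
  ; list     = tabulate (λ k → lookup (edges G) k , label G f k)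
  ; edges-↭  = ↭-reflexive (≡.trans (map-tabulate _ proj₁) (tabulate-lookup (edges G)))
  ; labels-↭ = ↭-trans (↭-reflexive (map-tabulate _ proj₂))
      (↭-trans (tabulate-∘-injective (suc ∘ toℕ) (Injection.injective (Inverse⇒Injection f)))
               (↭-reflexive (tabulate-rng 1 (numEdges G))))
  }

weight-fromEdgeLabeling : (G : Graph n) (f : EdgeLabeling G) (u : Fin n) →
                          weight (list (fromEdgeLabeling G f)) u ≡ vsum G f u
weight-fromEdgeLabeling G f u = cong sum (≡.trans (map-tabulate {n = numEdges G} _ _) (≡.sym (map-tabulate {n = numEdges G} id _)))

zip-positions : (L : List (A × ℕ)) (es : List A) → es ≡ map proj₁ L →
                Σ[ ℓ ∈ (Fin (length es) → ℕ) ] tabulate (λ k → lookup es k , ℓ k) ≡ L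
zip-positions []            []       refl = (λ ()) , refl
zip-positions ((_ , l) ∷ L) (e ∷ es) refl with zip-positions L es refl
... | ℓ , eq = (λ { zero → l ; (suc k) → ℓ k }) , cong ((e , l) ∷_) eq

labels⇒bijection : ∀ {q} (ℓ : Fin q → ℕ) → tabulate ℓ ↭ rng 1 q →
                   Σ[ f ∈ Fin q ↔ Fin q ] (∀ k → suc (toℕ (Inverse.to f k)) ≡ ℓ k)
labels⇒bijection {q} ℓ perm = mk↔ₛ′ to from to∘from from∘to , suc-to
  where
  bounds : ∀ k → 1 ≤ ℓ k × ℓ k < q + 1
  bounds k = All.lookup (rng-bound 1 q) (∈-resp-↭ perm (∈-tabulate⁺ k))
  pred< : ∀ {m} → 1 ≤ m → m < q + 1 → m ∸ 1 < q
  pred< {suc m} _ m<q = ≤-pred (subst (suc m <_) (+-comm q 1) m<q)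
  to : Fin q → Fin q
  to k = fromℕ< (pred< (proj₁ (bounds k)) (proj₂ (bounds k)))
  suc-to : ∀ k → suc (toℕ (to k)) ≡ ℓ k
  suc-to k = ≡.trans (cong suc (toℕ-fromℕ< _)) (m+[n∸m]≡n (proj₁ (bounds k)))
  preimage : ∀ i → ∃[ k ] suc (toℕ i) ≡ ℓ k
  preimage i = ∈-tabulate⁻ (∈-resp-↭ (↭-sym perm) (subst (suc (toℕ i) ∈_) (tabulate-rng 1 q) (∈-tabulate⁺ i)))
  from : Fin q → Fin q
  from i = proj₁ (preimage i)
  to∘from : ∀ i → to (from i) ≡ i
  to∘from i = toℕ-injective (suc-injective (≡.trans (suc-to (from i)) (≡.sym (proj₂ (preimage i)))))
  -- `to` undoes `from`, so `from` is injective, hence surjective on a finite set; this makes `to` a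
  -- two-sided inverse.
  from-surjective : ∀ k → ∃[ i ] k ≡ from i
  from-surjective k = ∈-tabulate⁻ (∈-resp-↭ (↭-sym (tabulate-∘-injective id
    (λ {i} {j} eq → ≡.trans (≡.sym (to∘from i)) (≡.trans (cong to eq) (to∘from j))))) (∈-allFin k))
  from∘to : ∀ k → from (to k) ≡ k
  from∘to k with from-surjective k
  ... | i , refl = cong from (to∘from i)

length-list : {G : Graph n} (L : Labelling G) → size L ≡ numEdges G
length-list {G = G} L = begin
  size L                        ≡⟨ length-rng 1 (size L) ⟨
  length (rng 1 (size L))       ≡⟨ ↭-length (labels-↭ L) ⟨
  length (map proj₂ (list L))   ≡⟨ ≡.trans (length-map proj₂ (list L)) (≡.sym (length-map proj₁ (list L))) ⟩
  length (map proj₁ (list L))   ≡⟨ ↭-length (edges-↭ L) ⟩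
  numEdges G                    ∎
  where open ≡.≡-Reasoning

toEdgeLabeling : (G : Graph n) (L : Labelling G) → Σ[ f ∈ EdgeLabeling G ] (∀ u → vsum G f u ≡ weight (list L) u)
-- The labelled edges are rearranged into the order of `edges G`; labels can then be read off by
-- position.
toEdgeLabeling G L with ↭-map-inv proj₁ (edges-↭ L)
... | L′ , edges≡ , L↭L′ = f , vsum≡
  where
  ℓ : Fin (numEdges G) → ℕ
  ℓ = proj₁ (zip-positions L′ (edges G) edges≡)
  zip≡ : tabulate (λ k → lookup (edges G) k , ℓ k) ≡ L′
  zip≡ = proj₂ (zip-positions L′ (edges G) edges≡)
  perm : tabulate ℓ ↭ rng 1 (numEdges G)
  perm = begin
    tabulate ℓ                                              ≡⟨ map-tabulate (λ k → lookup (edges G) k , ℓ k) proj₂ ⟨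
    map proj₂ (tabulate (λ k → lookup (edges G) k , ℓ k))   ≡⟨ cong (map proj₂) zip≡ ⟩
    map proj₂ L′                                            ↭⟨ map⁺ proj₂ L↭L′ ⟨
    map proj₂ (list L)                                      ↭⟨ labels-↭ L ⟩
    rng 1 (size L)                                          ≡⟨ cong (rng 1) (length-list L) ⟩
    rng 1 (numEdges G)                                      ∎
    where open PermutationReasoning
  f : EdgeLabeling G
  f = proj₁ (labels⇒bijection ℓ perm)
  vsum≡ : ∀ u → vsum G f u ≡ weight (list L) u
  vsum≡ u = begin
    vsum G f u                                                    ≡⟨ weight-fromEdgeLabeling G f u ⟨
    weight (tabulate (λ k → lookup (edges G) k , label G f k)) u  ≡⟨ cong (λ L → weight L u) (tabulate-cong (λ k → cong (lookup (edges G) k ,_) (proj₂ (labels⇒bijection ℓ perm) k))) ⟩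
    weight (tabulate (λ k → lookup (edges G) k , ℓ k)) u          ≡⟨ cong (λ L → weight L u) zip≡ ⟩
    weight L′ u                                                   ≡⟨ sum-↭ (map⁺ (λ (e , l) → if incident u e then l else 0) L↭L′) ⟨
    weight (list L) u                                             ∎
    where open ≡.≡-Reasoning

-- At most `degree G u` edges meet `u`, each labelled at most `size L`. This crude estimate is what
-- keeps old weights below new ones.
weight-≤ : {G : Graph n} (L : Labelling G) (u : Fin n) → weight (list L) u ≤ degree G u * size L
weight-≤ {G = G} L u = begin
  weight (list L) u                                        ≤⟨ bound (list L) labels≤ ⟩
  sum (map (incidence u) (map proj₁ (list L))) * size L    ≡⟨ cong (_* size L) (sum-↭ (map⁺ (incidence u) (edges-↭ L))) ⟩
  sum (map (incidence u) (edges G)) * size L               ≤⟨ *-monoˡ-≤ (size L) (incidence≤degree G u) ⟩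
  degree G u * size L                                      ∎
  where
  open ≤-Reasoning
  labels≤ : All (λ p → proj₂ p ≤ size L) (list L)
  labels≤ = All.map⁻ (Perm.All-resp-↭ (↭-sym (labels-↭ L))
    (All.map (λ {y} (_ , y<) → ≤-pred (subst (y <_) (+-comm (size L) 1) y<)) (rng-bound 1 (size L))))
  bound : ∀ M → All (λ p → proj₂ p ≤ size L) M → weight M u ≤ sum (map (incidence u) (map proj₁ M)) * size L
  bound []            []        = z≤n
  bound ((e , l) ∷ M) (l≤ ∷ M≤) with incident u e
  ... | true  = +-mono-≤ l≤ (bound M M≤)
  ... | false = bound M M≤

-- Joins with an edgeless graph

lift : ∀ s → Fin n × Fin n → Fin (n + s) × Fin (n + s)
lift s (i , j) = i ↑ˡ s , j ↑ˡ s

module Join {n : ℕ} (G : Graph n) (s : ℕ) where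

  J : Graph (n + s)
  J = G ∨G O s

  crossing : Fin n → Fin s → Fin (n + s) × Fin (n + s)
  crossing i j = i ↑ˡ s , n ↑ʳ j

  cell-left : ∀ i j → cell J (i ↑ˡ s) (j ↑ˡ s) ≡ map (lift s) (cell G i j)
  cell-left i j rewrite splitAt-↑ˡ n i s | splitAt-↑ˡ n j s | toℕ-↑ˡ i s | toℕ-↑ˡ j s
    with adj G i j ∧ (toℕ i <ᵇ toℕ j)
  ... | true  = refl
  ... | false = refl

  cell-crossing : ∀ i j → cell J (i ↑ˡ s) (n ↑ʳ j) ≡ [ crossing i j ]
  cell-crossing i j rewrite splitAt-↑ˡ n i s | splitAt-↑ʳ n s j | toℕ-↑ˡ i s | toℕ-↑ʳ n j
    with toℕ i <ᵇ n + toℕ j in eq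
  ... | true  = refl
  ... | false = contradiction (<⇒<ᵇ (<-≤-trans (toℕ<n i) (m≤m+n n (toℕ j)))) (subst T eq)

  cell-reversed : ∀ i j → cell J (n ↑ʳ i) (j ↑ˡ s) ≡ []
  cell-reversed i j rewrite splitAt-↑ˡ n j s | splitAt-↑ʳ n s i | toℕ-↑ˡ j s | toℕ-↑ʳ n i
    with n + toℕ i <ᵇ toℕ j in eq
  ... | false = refl
  ... | true  = contradiction (<ᵇ⇒< (n + toℕ i) (toℕ j) (subst T (≡.sym eq) _)) (≤⇒≯ (≤-trans (<⇒≤ (toℕ<n j)) (m≤m+n n (toℕ i))))

  cell-right : ∀ i j → cell J (n ↑ʳ i) (n ↑ʳ j) ≡ []
  cell-right i j rewrite splitAt-↑ʳ n s i | splitAt-↑ʳ n s j = refl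

  concat-cells : ∀ i → concat (tabulate (cell J i)) ≡
    concat (tabulate (λ j → cell J i (j ↑ˡ s))) ++ concat (tabulate (λ j → cell J i (n ↑ʳ j)))
  concat-cells i = ≡.trans (cong concat (tabulate-+ n (cell J i))) (≡.sym (concat-++ (tabulate (λ j → cell J i (j ↑ˡ s))) _))

  left-row : ∀ i → concat (tabulate (cell J (i ↑ˡ s))) ≡
             map (lift s) (concat (tabulate (cell G i))) ++ tabulate (crossing i)
  left-row i = ≡.trans (concat-cells (i ↑ˡ s)) (cong₂ _++_
    (begin
      concat (tabulate (λ j → cell J (i ↑ˡ s) (j ↑ˡ s)))   ≡⟨ cong concat (tabulate-cong (cell-left i)) ⟩
      concat (tabulate (map (lift s) ∘ cell G i))          ≡⟨ cong concat (map-tabulate (cell G i) (map (lift s))) ⟨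
      concat (map (map (lift s)) (tabulate (cell G i)))    ≡⟨ concat-map (tabulate (cell G i)) ⟩
      map (lift s) (concat (tabulate (cell G i)))          ∎)
    (≡.trans (cong concat (tabulate-cong (cell-crossing i))) (concat-singletons (crossing i))))
    where open ≡.≡-Reasoning

  right-row : ∀ i → concat (tabulate (cell J (n ↑ʳ i))) ≡ []
  right-row i = ≡.trans (concat-cells (n ↑ʳ i)) (cong₂ _++_
    (≡.trans (cong concat (tabulate-cong (cell-reversed i))) (concat-[] n))
    (≡.trans (cong concat (tabulate-cong (cell-right i))) (concat-[] s)))

  lift-edges : concat (tabulate (λ i → map (lift s) (concat (tabulate (cell G i))))) ≡ map (lift s) (edges G)
  lift-edges = begin
    concat (tabulate (map (lift s) ∘ row))    ≡⟨ cong concat (map-tabulate row (map (lift s))) ⟨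
    concat (map (map (lift s)) (tabulate row)) ≡⟨ concat-map (tabulate row) ⟩
    map (lift s) (concat (tabulate row))      ≡⟨ cong (map (lift s)) (edges-cells G) ⟨
    map (lift s) (edges G)                    ∎
    where
    open ≡.≡-Reasoning
    row = λ i → concat (tabulate (cell G i))

  -- The enumeration by rows puts the crossing edges of a vertex right after its old edges, so the
  -- two kinds are interleaved and only a permutation can be stated. New vertices have empty rows
  -- because each edge is listed at its smaller end.
  join-edges : edges J ↭ map (lift s) (edges G) ++ entries crossing
  join-edges = begin
    edges J
      ≡⟨ edges-cells J ⟩
    concat (tabulate (λ i → concat (tabulate (cell J i))))
      ≡⟨ cong concat (tabulate-+ n (λ i → concat (tabulate (cell J i)))) ⟩
    concat (tabulate (λ i → concat (tabulate (cell J (i ↑ˡ s)))) ++ tabulate (λ i → concat (tabulate (cell J (n ↑ʳ i)))))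
      ≡⟨ concat-++ (tabulate (λ i → concat (tabulate (cell J (i ↑ˡ s))))) _ ⟨
    concat (tabulate (λ i → concat (tabulate (cell J (i ↑ˡ s))))) ++ concat (tabulate (λ i → concat (tabulate (cell J (n ↑ʳ i)))))
      ≡⟨ cong₂ _++_ (cong concat (tabulate-cong left-row)) (≡.trans (cong concat (tabulate-cong right-row)) (concat-[] s)) ⟩
    concat (tabulate (λ i → map (lift s) (concat (tabulate (cell G i))) ++ tabulate (crossing i))) ++ []
      ↭⟨ Perm.++-identityʳ _ ⟩
    concat (tabulate (λ i → map (lift s) (concat (tabulate (cell G i))) ++ tabulate (crossing i)))
      ↭⟨ concat-tabulate-++ (λ i → map (lift s) (concat (tabulate (cell G i)))) (λ i → tabulate (crossing i)) ⟩
    concat (tabulate (λ i → map (lift s) (concat (tabulate (cell G i))))) ++ entries crossing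
      ≡⟨ cong (_++ entries crossing) lift-edges ⟩
    map (lift s) (edges G) ++ entries crossing ∎
    where open PermutationReasoning

  ≟-↑ˡ : ∀ (u i : Fin n) → does (u ↑ˡ s F.≟ i ↑ˡ s) ≡ does (u F.≟ i)
  ≟-↑ˡ u i with u F.≟ i
  ... | yes refl = dec-true (u ↑ˡ s F.≟ u ↑ˡ s) refl
  ... | no  u≢i  = dec-false (u ↑ˡ s F.≟ i ↑ˡ s) (u≢i ∘ ↑ˡ-injective s u i)

  ≟-↑ʳ : ∀ (v j : Fin s) → does (n ↑ʳ v F.≟ n ↑ʳ j) ≡ does (v F.≟ j)
  ≟-↑ʳ v j with v F.≟ j
  ... | yes refl = dec-true (n ↑ʳ v F.≟ n ↑ʳ v) refl
  ... | no  v≢j  = dec-false (n ↑ʳ v F.≟ n ↑ʳ j) (v≢j ∘ F.↑ʳ-injective n v j)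

  ↑ˡ≢↑ʳ : ∀ (i : Fin n) (j : Fin s) → i ↑ˡ s ≢ n ↑ʳ j
  ↑ˡ≢↑ʳ i j eq = <⇒≢ (<-≤-trans (toℕ<n i) (m≤m+n n (toℕ j)))
    (≡.trans (≡.sym (toℕ-↑ˡ i s)) (≡.trans (cong toℕ eq) (toℕ-↑ʳ n j)))

  ≟-left-right : ∀ (i : Fin n) (j : Fin s) → does (i ↑ˡ s F.≟ n ↑ʳ j) ≡ false
  ≟-left-right i j = dec-false (i ↑ˡ s F.≟ n ↑ʳ j) (↑ˡ≢↑ʳ i j)

  ≟-right-left : ∀ (j : Fin s) (i : Fin n) → does (n ↑ʳ j F.≟ i ↑ˡ s) ≡ false
  ≟-right-left j i = dec-false (n ↑ʳ j F.≟ i ↑ˡ s) (↑ˡ≢↑ʳ i j ∘ ≡.sym)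

  incident-left : ∀ u e → incident (u ↑ˡ s) (lift s e) ≡ incident u e
  incident-left u (a , b) = cong₂ _∨_ (≟-↑ˡ u a) (≟-↑ˡ u b)

  incident-right : ∀ v e → incident (n ↑ʳ v) (lift s e) ≡ false
  incident-right v (a , b) = cong₂ _∨_ (≟-right-left v a) (≟-right-left v b)

  incident-crossingˡ : ∀ u i j → incident (u ↑ˡ s) (crossing i j) ≡ does (u F.≟ i)
  incident-crossingˡ u i j = ≡.trans (cong₂ _∨_ (≟-↑ˡ u i) (≟-left-right u j)) (∨-identityʳ (does (u F.≟ i)))

  incident-crossingʳ : ∀ v i j → incident (n ↑ʳ v) (crossing i j) ≡ does (v F.≟ j)
  incident-crossingʳ v i j = cong₂ _∨_ (≟-right-left v i) (≟-↑ʳ v j)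

  module Extend (L : Labelling G) (M : Fin n → Fin s → ℕ) (M-↭ : entries M ↭ rng (size L + 1) (n * s)) where

    labelled : Fin n → Fin s → (Fin (n + s) × Fin (n + s)) × ℕ
    labelled i j = crossing i j , M i j

    crossings : List ((Fin (n + s) × Fin (n + s)) × ℕ)
    crossings = entries labelled

    lifted : List ((Fin (n + s) × Fin (n + s)) × ℕ)
    lifted = map (λ (e , l) → lift s e , l) (list L)

    extend : Labelling J
    extend = record
      { size     = size L + n * s
      ; list     = lifted ++ crossings
      ; edges-↭  = begin
          map proj₁ (lifted ++ crossings)                  ≡⟨ map-++ proj₁ lifted crossings ⟩
          map proj₁ lifted ++ map proj₁ crossings          ≡⟨ cong₂ _++_ (≡.trans (≡.sym (map-∘ (list L))) (map-∘ (list L))) (map-entries proj₁ labelled) ⟩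
          map (lift s) (map proj₁ (list L)) ++ entries crossing ↭⟨ ++⁺ʳ (entries crossing) (map⁺ (lift s) (edges-↭ L)) ⟩
          map (lift s) (edges G) ++ entries crossing       ↭⟨ join-edges ⟨
          edges J                                          ∎
      ; labels-↭ = begin
          map proj₂ (lifted ++ crossings)                  ≡⟨ map-++ proj₂ lifted crossings ⟩
          map proj₂ lifted ++ map proj₂ crossings          ≡⟨ cong₂ _++_ (≡.sym (map-∘ (list L))) (map-entries proj₂ labelled) ⟩
          map proj₂ (list L) ++ entries M                  ↭⟨ ++⁺ (labels-↭ L) M-↭ ⟩
          rng 1 (size L) ++ rng (size L + 1) (n * s)       ≡⟨ rng-++ 1 (size L) (n * s) ⟨
          rng 1 (size L + n * s)                           ∎
      }
      where open PermutationReasoning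

    weight-extend : ∀ u → weight (lifted ++ crossings) u ≡
      sum (map (λ (e , l) → if incident u (lift s e) then l else 0) (list L)) +
      ∑ (λ i → ∑ (λ j → if incident u (crossing i j) then M i j else 0))
    weight-extend u = begin
      sum (map g (lifted ++ crossings))                 ≡⟨ cong sum (map-++ g lifted crossings) ⟩
      sum (map g lifted ++ map g crossings)             ≡⟨ sum-++ (map g lifted) _ ⟩
      sum (map g lifted) + sum (map g crossings)        ≡⟨ cong₂ _+_ (cong sum (≡.sym (map-∘ (list L)))) (≡.trans (cong sum (map-entries g labelled)) (sum-entries (λ i j → g (labelled i j)))) ⟩
      _ ∎
      where
      open ≡.≡-Reasoning
      g : (Fin (n + s) × Fin (n + s)) × ℕ → ℕ
      g (e , l) = if incident u e then l else 0

    weight-left : ∀ u → weight (list extend) (u ↑ˡ s) ≡ weight (list L) u + ∑ (M u)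
    weight-left u = ≡.trans (weight-extend (u ↑ˡ s)) (cong₂ _+_
      (cong sum (map-cong (λ (e , l) → cong (if_then l else 0) (incident-left u e)) (list L)))
      (begin
        ∑ (λ i → ∑ (λ j → if incident (u ↑ˡ s) (crossing i j) then M i j else 0))
          ≡⟨ ∑-cong (λ i → ∑-cong (λ j → cong (if_then M i j else 0) (incident-crossingˡ u i j))) ⟩
        ∑ (λ i → ∑ (λ j → δ u i (M i j)))   ≡⟨ ∑-swap (λ i j → δ u i (M i j)) ⟩
        ∑ (λ j → ∑ (λ i → δ u i (M i j)))   ≡⟨ ∑-cong (λ j → ∑-δ u (λ i → M i j)) ⟩
        ∑ (M u)                             ∎))
      where open ≡.≡-Reasoning

    weight-right : ∀ v → weight (list extend) (n ↑ʳ v) ≡ ∑ (λ i → M i v)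
    weight-right v = ≡.trans (weight-extend (n ↑ʳ v)) (cong₂ _+_
      (≡.trans (cong sum (map-cong (λ (e , l) → cong (if_then l else 0) (incident-right v e)) (list L))) (sum-0 (list L)))
      (∑-cong (λ i → ≡.trans (∑-cong (λ j → cong (if_then M i j else 0) (incident-crossingʳ v i j))) (∑-δ v (M i)))))
      where
      sum-0 : (xs : List A) → sum (map (λ _ → 0) xs) ≡ 0
      sum-0 []       = refl
      sum-0 (x ∷ xs) = sum-0 xs

  -- A new vertex sees the `n` old ones and an old vertex gains `s` neighbours; `d + s ≡ n` is what
  -- makes the two degrees equal.
  join-regular : ∀ {d} → d + s ≡ n → Regular d G → Regular (d + s) J
  join-regular {d} d+s≡n reg u = ≡.trans (cong sum (map-tabulate id (λ v → if adj J u v then 1 else 0)))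
    (≡.trans (∑-↑ n (λ v → if adj J u v then 1 else 0)) (degree-split u))
    where
    ones : ∀ m → ∑ {m} (λ _ → 1) ≡ m
    ones m = ≡.trans (∑-const m 1) (*-identityʳ m)
    adj-↑ˡ : ∀ u j → adj J u (j ↑ˡ s) ≡ joinAdj (adj G) (adj (O s)) (splitAt n u) (inj₁ j)
    adj-↑ˡ u j = cong (joinAdj (adj G) (adj (O s)) (splitAt n u)) (splitAt-↑ˡ n j s)
    adj-↑ʳ : ∀ u j → adj J u (n ↑ʳ j) ≡ joinAdj (adj G) (adj (O s)) (splitAt n u) (inj₂ j)
    adj-↑ʳ u j = cong (joinAdj (adj G) (adj (O s)) (splitAt n u)) (splitAt-↑ʳ n s j)
    degree-split : ∀ u → ∑ (λ j → if adj J u (j ↑ˡ s) then 1 else 0) + ∑ (λ j → if adj J u (n ↑ʳ j) then 1 else 0) ≡ d + s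
    degree-split u = ≡.trans (cong₂ _+_ (∑-cong (λ j → cong (if_then 1 else 0) (adj-↑ˡ u j))) (∑-cong (λ j → cong (if_then 1 else 0) (adj-↑ʳ u j)))) (value (splitAt n u))
      where
      value : ∀ x → ∑ (λ j → if joinAdj (adj G) (adj (O s)) x (inj₁ j) then 1 else 0) +
                    ∑ (λ j → if joinAdj (adj G) (adj (O s)) x (inj₂ j) then 1 else 0) ≡ d + s
      value (inj₁ i) = cong₂ _+_ (≡.trans (≡.sym (cong sum (map-tabulate id (λ v → if adj G i v then 1 else 0)))) (reg i)) (ones s)
      value (inj₂ i) = ≡.trans (cong₂ _+_ (ones n) (∑-zero s)) (≡.trans (+-identityʳ n) (≡.sym d+s≡n))

-- Colourings from magic rectangles

module _ {a b : ℕ} (X : Magic a b) where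
  open Magic X

  magic-count : a * ρ ≡ b * κ
  magic-count = begin
    a * ρ                            ≡⟨ ∑-const a ρ ⟨
    ∑ {a} (λ _ → ρ)                  ≡⟨ ∑-cong rows ⟨
    ∑ (λ i → ∑ (matrix i))           ≡⟨ ∑-swap matrix ⟩
    ∑ (λ j → ∑ (λ i → matrix i j))   ≡⟨ ∑-cong cols ⟩
    ∑ {b} (λ _ → κ)                  ≡⟨ ∑-const b κ ⟩
    b * κ                            ∎
    where open ≡.≡-Reasoning

  magic-bounds : ∀ i j → 1 ≤ matrix i j × matrix i j < a * b + 1
  magic-bounds i j = All.lookup (rng-bound 1 (a * b)) (∈-resp-↭ ents (∈-entries matrix i j))

  ρ≤ : Fin a → ρ ≤ b * (a * b)
  ρ≤ i = begin
    ρ                        ≡⟨ rows i ⟨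
    ∑ (matrix i)             ≤⟨ ∑-mono (λ j → ≤-pred (subst (matrix i j <_) (+-comm (a * b) 1) (proj₂ (magic-bounds i j)))) ⟩
    ∑ {b} (λ _ → a * b)      ≡⟨ ∑-const b (a * b) ⟩
    b * (a * b)              ∎
    where open ≤-Reasoning

  -- By `a * ρ ≡ b * κ`: if `κ ≤ ρ`, then `b * κ < a * κ ≤ a * ρ`, where strictness holds because
  -- the entries, and so `κ`, are positive.
  ρ<κ : 1 ≤ b → b < a → ρ < κ
  ρ<κ 1≤b b<a with ρ <? κ
  ... | yes ρ<κ = ρ<κ
  ... | no  ρ≮κ = contradiction (begin-strict
      b * κ  <⟨ *-monoˡ-< κ {{>-nonZero 1≤κ}} b<a ⟩
      a * κ  ≤⟨ *-monoʳ-≤ a (≮⇒≥ ρ≮κ) ⟩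
      a * ρ  ≡⟨ magic-count ⟩
      b * κ  ∎) (<-irrefl refl)
    where
    open ≤-Reasoning
    1≤κ : 1 ≤ κ
    1≤κ = begin
      1                                          ≤⟨ ≤-trans 1≤b (<⇒≤ b<a) ⟩
      a                                          ≡⟨ *-identityʳ a ⟨
      a * 1                                      ≡⟨ ∑-const a 1 ⟨
      ∑ {a} (λ _ → 1)                            ≤⟨ ∑-mono (λ i → proj₁ (magic-bounds i (fromℕ< 1≤b))) ⟩
      ∑ (λ i → matrix i (fromℕ< 1≤b))            ≡⟨ cols (fromℕ< 1≤b) ⟩
      κ                                          ∎

  shifted : ℕ → Fin a → Fin b → ℕ
  shifted t i j = t + matrix i j

  shifted-rows : ∀ t i → ∑ (shifted t i) ≡ b * t + ρ
  shifted-rows t i = ≡.trans (∑-+ (λ _ → t) (matrix i)) (cong₂ _+_ (∑-const b t) (rows i))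

  shifted-cols : ∀ t j → ∑ (λ i → shifted t i j) ≡ a * t + κ
  shifted-cols t j = ≡.trans (∑-+ (λ _ → t) (λ i → matrix i j)) (cong₂ _+_ (∑-const a t) (cols j))

  shifted-entries : ∀ t → entries (shifted t) ↭ rng (t + 1) (a * b)
  shifted-entries t = ↭-trans (↭-reflexive (≡.sym (map-entries (t +_) matrix)))
    (↭-trans (map⁺ (t +_) ents) (↭-reflexive (map-rng 1 (a * b))))
    where
    map-rng : ∀ x n → map (t +_) (rng x n) ≡ rng (t + x) n
    map-rng x zero    = refl
    map-rng x (suc n) = cong (t + x ∷_) (≡.trans (map-rng (suc x) n) (cong (λ y → rng y n) (+-suc t x)))

record Coloured (G : Graph n) (c : ℕ) : Set where
  field
    labelling : Labelling G
    proper    : ∀ u v → adj G u v ≡ true → weight (list labelling) u ≢ weight (list labelling) v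
    colours   : List ℕ
    count     : length colours ≡ c
    coloured  : ∀ u → weight (list labelling) u ∈ colours

module JoinColoured {n : ℕ} (G : Graph n) (s : ℕ) (L : Labelling G)
  (M : Fin n → Fin s → ℕ) (M-↭ : entries M ↭ rng (size L + 1) (n * s)) where

  open Join G s
  open Extend L M M-↭

  weight-join : ∀ w → weight (list extend) w ≡
                [ (λ u → weight (list L) u + ∑ (M u)) , (λ v → ∑ (λ i → M i v)) ]′ (splitAt n w)
  weight-join w with splitAt n w in eq
  ... | inj₁ u = ≡.trans (cong (weight (list extend)) (≡.sym (splitAt⁻¹-↑ˡ eq))) (weight-left u)
  ... | inj₂ v = ≡.trans (cong (weight (list extend)) (≡.sym (splitAt⁻¹-↑ʳ eq))) (weight-right v)

  join-coloured : ∀ {c} κ (f : Fin n → ℕ) → (∀ u → weight (list L) u + ∑ (M u) ≡ f u) → (∀ v → ∑ (λ i → M i v) ≡ κ) →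
    (∀ u v → adj G u v ≡ true → f u ≢ f v) → (∀ u → f u < κ) →
    (cs : List ℕ) → length cs ≡ c → (∀ u → f u ∈ cs) → Coloured J (suc c)
  join-coloured {c} κ f rows cols prop f<κ cs len mem = record
    { labelling = extend
    ; proper    = λ u v uv eq → proper (splitAt n u) (splitAt n v) uv
        (≡.trans (≡.sym (weight≡ u)) (≡.trans eq (weight≡ v)))
    ; colours   = κ ∷ cs
    ; count     = cong suc len
    ; coloured  = λ u → subst (_∈ κ ∷ cs) (≡.sym (weight≡ u)) (member (splitAt n u))
    }
    where
    weight≡ : ∀ w → weight (list extend) w ≡ [ f , (λ _ → κ) ]′ (splitAt n w)
    weight≡ w = ≡.trans (weight-join w) (value (splitAt n w))
      where
      value : ∀ x → [ (λ u → weight (list L) u + ∑ (M u)) , (λ v → ∑ (λ i → M i v)) ]′ x ≡ [ f , (λ _ → κ) ]′ x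
      value (inj₁ u) = rows u
      value (inj₂ v) = cols v
    proper : ∀ x y → joinAdj (adj G) (adj (O s)) x y ≡ true → [ f , (λ _ → κ) ]′ x ≢ [ f , (λ _ → κ) ]′ y
    proper (inj₁ u) (inj₁ v) uv = prop u v uv
    proper (inj₁ u) (inj₂ v) uv = <⇒≢ (f<κ u)
    proper (inj₂ u) (inj₁ v) uv = >⇒≢ (f<κ v)
    proper (inj₂ u) (inj₂ v) ()
    member : ∀ x → [ f , (λ _ → κ) ]′ x ∈ κ ∷ cs
    member (inj₁ u) = there (mem u)
    member (inj₂ v) = here refl

module Steps {n d s : ℕ} (G : Graph n) (reg : Regular d G) (d+s≡n : d + s ≡ n) (1≤d : 1 ≤ d) (1≤s : 1 ≤ s)
  {c : ℕ} (C : Coloured G c) (X : Magic n s) where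

  open Coloured C
  module X = Magic X

  L : Labelling G
  L = labelling

  q N : ℕ
  q = size L
  N = n * s

  s<n : s < n
  s<n = subst (s <_) d+s≡n (+-monoˡ-≤ s 1≤d)

  -- An old vertex has `d` edges labelled at most `q`, and `d + s ≡ n`. The term `s * q` is the
  -- shift of its new edges and `n * q` the shift collected by a new vertex, so `ρ < κ` is all that
  -- is left for separating them.
  w≤ : ∀ u → weight (list L) u + s * q ≤ n * q
  w≤ u = begin
    weight (list L) u + s * q   ≤⟨ +-monoˡ-≤ (s * q) (weight-≤ L u) ⟩
    degree G u * q + s * q      ≡⟨ cong (λ e → e * q + s * q) (reg u) ⟩
    d * q + s * q               ≡⟨ *-distribʳ-+ q d s ⟨
    (d + s) * q                 ≡⟨ cong (_* q) d+s≡n ⟩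
    n * q                       ∎
    where open ≤-Reasoning

  shift-proper : ∀ t u v → adj G u v ≡ true → weight (list L) u + t ≢ weight (list L) v + t
  shift-proper t u v uv eq = proper u v uv (+-cancelʳ-≡ t _ _ eq)

  open JoinColoured G s L (shifted X q) (shifted-entries X q)

  join-one : Coloured (G ∨G O s) (suc c)
  join-one = join-coloured (n * q + X.κ) (λ u → weight (list L) u + t)
    (λ u → cong (weight (list L) u +_) (shifted-rows X q u)) (shifted-cols X q) (shift-proper t)
    (λ u → begin-strict
      weight (list L) u + (s * q + X.ρ)   ≡⟨ +-assoc (weight (list L) u) (s * q) X.ρ ⟨
      weight (list L) u + s * q + X.ρ     <⟨ +-mono-≤-< (w≤ u) (ρ<κ X 1≤s s<n) ⟩
      n * q + X.κ                         ∎)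
    (map (_+ t) colours) (≡.trans (length-map (_+ t) colours) count) (λ u → ∈-map⁺ (_+ t) (coloured u))
    where
    open ≤-Reasoning
    t = s * q + X.ρ

  module _ (Y : Magic s s) where
    private module Y = Magic Y

    q₁ : ℕ
    q₁ = q + N

    L₁ : Labelling (G ∨G O s)
    L₁ = Join.Extend.extend G s L (shifted X q) (shifted-entries X q)

    M₂ : Fin (n + s) → Fin s → ℕ
    M₂ i = [ shifted X q₁ , shifted Y (q₁ + N) ]′ (splitAt n i)

    M₂-left : ∀ i → M₂ (i ↑ˡ s) ≡ shifted X q₁ i
    M₂-left i = cong [ shifted X q₁ , shifted Y (q₁ + N) ]′ (splitAt-↑ˡ n i s)

    M₂-right : ∀ i → M₂ (n ↑ʳ i) ≡ shifted Y (q₁ + N) i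
    M₂-right i = cong [ shifted X q₁ , shifted Y (q₁ + N) ]′ (splitAt-↑ʳ n s i)

    M₂-↭ : entries M₂ ↭ rng (q₁ + 1) ((n + s) * s)
    M₂-↭ = begin
      entries M₂
        ≡⟨ cong concat (tabulate-+ n (tabulate ∘ M₂)) ⟩
      concat (tabulate (λ i → tabulate (M₂ (i ↑ˡ s))) ++ tabulate (λ i → tabulate (M₂ (n ↑ʳ i))))
        ≡⟨ concat-++ (tabulate (λ i → tabulate (M₂ (i ↑ˡ s)))) _ ⟨
      entries (M₂ ∘ (_↑ˡ s)) ++ entries (M₂ ∘ (n ↑ʳ_))
        ≡⟨ cong₂ _++_ (cong concat (tabulate-cong (cong tabulate ∘ M₂-left))) (cong concat (tabulate-cong (cong tabulate ∘ M₂-right))) ⟩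
      entries (shifted X q₁) ++ entries (shifted Y (q₁ + N))
        ↭⟨ ++⁺ (shifted-entries X q₁) (shifted-entries Y (q₁ + N)) ⟩
      rng (q₁ + 1) N ++ rng (q₁ + N + 1) (s * s)
        ≡⟨ cong (λ y → rng (q₁ + 1) N ++ rng y (s * s)) (≡.trans (cong (_+ 1) (+-comm q₁ N)) (+-assoc N q₁ 1)) ⟩
      rng (q₁ + 1) N ++ rng (N + (q₁ + 1)) (s * s)
        ≡⟨ rng-++ (q₁ + 1) N (s * s) ⟨
      rng (q₁ + 1) (N + s * s)
        ≡⟨ cong (rng (q₁ + 1)) (*-distribʳ-+ s n s) ⟨
      rng (q₁ + 1) ((n + s) * s) ∎
      where open PermutationReasoning

    -- `tG` is the total gain of each vertex of `G` over both joins, `κA` the final weight on the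
    -- first `O s`, and `κB` that on the second.
    κA κB tG : ℕ
    tG = (s * q + X.ρ) + (s * q₁ + X.ρ)
    κA = (n * q + X.κ) + (s * (q₁ + N) + Y.ρ)
    κB = (n * q₁ + X.κ) + (s * (q₁ + N) + Y.κ)

    value : Fin n ⊎ Fin s → ℕ
    value = [ (λ u → weight (list L) u + tG) , (λ _ → κA) ]′

    -- The first join contributes `w + s * q ≤ n * q` and `ρ < κ`. The row sum of the second copy is
    -- at most `s * N`, which the shift `q₁ + N` of the square pays for.
    G<A : ∀ u → weight (list L) u + tG < κA
    G<A u = begin-strict
      weight (list L) u + ((s * q + X.ρ) + (s * q₁ + X.ρ))     ≡⟨ lemma₁ (weight (list L) u) (s * q) X.ρ (s * q₁) ⟩
      (weight (list L) u + s * q) + (s * q₁ + X.ρ) + X.ρ       <⟨ +-mono-≤-< (+-mono-≤ (w≤ u) (+-monoʳ-≤ (s * q₁) (ρ≤ X (fromℕ< (≤-trans 1≤s (<⇒≤ s<n)))))) (ρ<κ X 1≤s s<n) ⟩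
      n * q + (s * q₁ + s * N) + X.κ                           ≤⟨ m≤m+n _ Y.ρ ⟩
      n * q + (s * q₁ + s * N) + X.κ + Y.ρ                     ≡⟨ lemma₂ (n * q) s q₁ N X.κ Y.ρ ⟩
      κA                                                       ∎
      where
      open ≤-Reasoning
      lemma₁ : ∀ w a r b → w + ((a + r) + (b + r)) ≡ (w + a) + (b + r) + r
      lemma₁ = ℕ-Solver.solve-∀
      lemma₂ : ∀ a s q N k r → a + (s * q + s * N) + k + r ≡ (a + k) + (s * (q + N) + r)
      lemma₂ = ℕ-Solver.solve-∀

    -- Both sides contain `s * (q₁ + N)`, and the two line sums of a square coincide by
    -- `magic-count`; the rest differs by `q < q₁`.
    A<B : κA < κB
    A<B = +-mono-<-≤ (+-monoˡ-< X.κ (*-monoʳ-< n {{>-nonZero 1≤n}} (m<m+n q (*-mono-≤ 1≤n 1≤s))))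
      (+-monoʳ-≤ (s * (q₁ + N)) (≤-reflexive (*-cancelˡ-≡ Y.ρ Y.κ s {{>-nonZero 1≤s}} (magic-count Y))))
      where
      1≤n : 1 ≤ n
      1≤n = ≤-trans 1≤s (<⇒≤ s<n)

    join-two : Coloured ((G ∨G O s) ∨G O s) (suc (suc c))
    join-two = JoinColoured.join-coloured (G ∨G O s) s L₁ M₂ M₂-↭ κB (value ∘ splitAt n) rows₂ cols₂
      (λ u v → proper₂ (splitAt n u) (splitAt n v)) (λ u → below (splitAt n u))
      (κA ∷ map (_+ tG) colours) (cong suc (≡.trans (length-map (_+ tG) colours) count)) (λ u → member (splitAt n u))
      where
      rows₂ : ∀ w → weight (list L₁) w + ∑ (M₂ w) ≡ value (splitAt n w)
      rows₂ w = ≡.trans (cong (_+ ∑ (M₂ w)) (weight-join w)) (row (splitAt n w))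
        where
        row : ∀ x → [ (λ u → weight (list L) u + ∑ (shifted X q u)) , (λ v → ∑ (λ i → shifted X q i v)) ]′ x
                    + ∑ ([ shifted X q₁ , shifted Y (q₁ + N) ]′ x) ≡ value x
        row (inj₁ u) = ≡.trans (+-assoc (weight (list L) u) _ _) (cong (weight (list L) u +_) (cong₂ _+_ (shifted-rows X q u) (shifted-rows X q₁ u)))
        row (inj₂ v) = cong₂ _+_ (shifted-cols X q v) (shifted-rows Y (q₁ + N) v)
      cols₂ : ∀ v → ∑ (λ i → M₂ i v) ≡ κB
      cols₂ v = ≡.trans (∑-↑ n (λ i → M₂ i v)) (cong₂ _+_
        (≡.trans (∑-cong (λ i → ≡.cong-app (M₂-left i) v)) (shifted-cols X q₁ v))
        (≡.trans (∑-cong (λ i → ≡.cong-app (M₂-right i) v)) (shifted-cols Y (q₁ + N) v)))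
      proper₂ : ∀ x y → joinAdj (adj G) (adj (O s)) x y ≡ true → value x ≢ value y
      proper₂ (inj₁ u) (inj₁ v) uv = shift-proper tG u v uv
      proper₂ (inj₁ u) (inj₂ v) uv = <⇒≢ (G<A u)
      proper₂ (inj₂ u) (inj₁ v) uv = >⇒≢ (G<A v)
      proper₂ (inj₂ u) (inj₂ v) ()
      below : ∀ x → value x < κB
      below (inj₁ u) = <-trans (G<A u) A<B
      below (inj₂ v) = A<B
      member : ∀ x → value x ∈ κA ∷ map (_+ tG) colours
      member (inj₁ u) = there (∈-map⁺ (_+ tG) (coloured u))
      member (inj₂ v) = here refl

-- Lower bounds

NeedsColours : Graph n → ℕ → Set
NeedsColours {n} G c = ∀ m (f : Fin n → Fin m) → ProperColoring G m f → c ≤ m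

join-needs : ∀ {s c} (G : Graph n) → 1 ≤ s → NeedsColours G c → NeedsColours (G ∨G O s) (suc c)
join-needs {n} {s} G 1≤s needs zero f prop with () ← f (n ↑ʳ fromℕ< 1≤s)
join-needs {n} {s} G 1≤s needs (suc m) f prop = s≤s (needs m g g-proper)
  where
  v : Fin (n + s)
  v = n ↑ʳ fromℕ< 1≤s
  avoid : ∀ u → f v ≢ f (u ↑ˡ s)
  avoid u = prop v (u ↑ˡ s) (cong₂ (joinAdj (adj G) (adj (O s))) (splitAt-↑ʳ n s (fromℕ< 1≤s)) (splitAt-↑ˡ n u s))
  g : Fin n → Fin m
  g u = punchOut (avoid u)
  g-proper : ProperColoring G m g
  g-proper u w uw eq = prop (u ↑ˡ s) (w ↑ˡ s)
    (≡.trans (cong₂ (joinAdj (adj G) (adj (O s))) (splitAt-↑ˡ n u s) (splitAt-↑ˡ n w s)) uw)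
    (punchOut-injective (avoid u) (avoid w) eq)

module _ (G : Graph n) (f : EdgeLabeling G) where

  palette : List ℕ
  palette = deduplicate _≟_ (map (vsum G f) (allFin n))

  vsum∈palette : ∀ u → vsum G f u ∈ palette
  vsum∈palette u = ∈-deduplicate⁺ _≟_ (∈-map⁺ (vsum G f) (∈-allFin u))

  -- The inequality between χ and χ_la: the weights form a proper colouring, with positions in
  -- `palette` as colours.
  numColors-≥ : ∀ {c} → NeedsColours G c → IsLocalAntimagic G f → c ≤ numColors G f
  numColors-≥ needs la = needs (numColors G f) (λ u → index (vsum∈palette u))
    (λ u v uv eq → la u v uv (≡.trans (lookup-index (vsum∈palette u))
      (≡.trans (cong (lookup palette) eq) (≡.sym (lookup-index (vsum∈palette v))))))

  numColors-≤ : ∀ cs → (∀ u → vsum G f u ∈ cs) → numColors G f ≤ length cs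
  numColors-≤ cs mem = unique-⊆⇒length≤ (deduplicate-! (map (vsum G f) (allFin n))) subset
    where
    subset : ∀ {x} → x ∈ palette → x ∈ cs
    subset x∈ with ∈-map⁻ (vsum G f) (∈-deduplicate⁻ _≟_ (map (vsum G f) (allFin n)) x∈)
    ... | u , _ , refl = mem u

coloured⇒χla : (G : Graph n) {c : ℕ} → Coloured G c → NeedsColours G c → IsLocalAntimagicChromaticNumber G c
coloured⇒χla G {c} C needs = (f , la , ≤-antisym upper (numColors-≥ G f needs la)) , λ f → numColors-≥ G f needs
  where
  open Coloured C
  f : EdgeLabeling G
  f = proj₁ (toEdgeLabeling G labelling)
  vsum≡ : ∀ u → vsum G f u ≡ weight (list labelling) u
  vsum≡ = proj₂ (toEdgeLabeling G labelling)
  la : IsLocalAntimagic G f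
  la u v uv eq = proper u v uv (≡.trans (≡.sym (vsum≡ u)) (≡.trans eq (vsum≡ v)))
  upper : numColors G f ≤ c
  upper = subst (numColors G f ≤_) count (numColors-≤ G f colours (λ u → subst (_∈ colours) (≡.sym (vsum≡ u)) (coloured u)))

χla⇒coloured : (G : Graph n) {c : ℕ} → IsLocalAntimagicChromaticNumber G c → Coloured G c
χla⇒coloured G ((f , la , count) , _) = record
  { labelling = fromEdgeLabeling G f
  ; proper    = λ u v uv eq → la u v uv (≡.trans (≡.sym (weight≡ u)) (≡.trans eq (weight≡ v)))
  ; colours   = palette G f
  ; count     = count
  ; coloured  = λ u → subst (_∈ palette G f) (≡.sym (weight≡ u)) (vsum∈palette G f u)
  }
  where weight≡ = weight-fromEdgeLabeling G f

open import Data.Integer using (ℤ; +_; -[1+_]; 0ℤ; 1ℤ; ∣_∣) renaming (_+_ to _+ᶻ_; _*_ to _*ᶻ_; -_ to -ᶻ_)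
import Data.Integer.Properties as ℤ
import Data.Integer.Tactic.RingSolver as ℤ-Solver

-- Integer matrices with prescribed row and column sums

sumℤ : List ℤ → ℤ
sumℤ = foldr _+ᶻ_ 0ℤ

∑ℤ : ∀ {n} → (Fin n → ℤ) → ℤ
∑ℤ f = sumℤ (tabulate f)

sumℤ-++ : ∀ xs ys → sumℤ (xs ++ ys) ≡ sumℤ xs +ᶻ sumℤ ys
sumℤ-++ []       ys = ≡.sym (ℤ.+-identityˡ _)
sumℤ-++ (x ∷ xs) ys = ≡.trans (cong (x +ᶻ_) (sumℤ-++ xs ys)) (≡.sym (ℤ.+-assoc x _ _))

∑ℤ-cong : ∀ {n} {f g : Fin n → ℤ} → (∀ i → f i ≡ g i) → ∑ℤ f ≡ ∑ℤ g
∑ℤ-cong p = cong sumℤ (tabulate-cong p)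

∑ℤ-↑ : ∀ m {n} (f : Fin (m + n) → ℤ) → ∑ℤ f ≡ ∑ℤ (f ∘ (_↑ˡ n)) +ᶻ ∑ℤ (f ∘ (m ↑ʳ_))
∑ℤ-↑ m {n} f = ≡.trans (cong sumℤ (tabulate-+ m f)) (sumℤ-++ (tabulate (f ∘ (_↑ˡ n))) _)

-- Row sums may vary with the row while columns share one sum: tiles set side by side have to cancel
-- their row sums only in total. Entries count up to permutation, so gluing tiles just concatenates
-- their lists.
record Block (a b : ℕ) (rowSum : Fin a → ℤ) (colSum : ℤ) (xs : List ℤ) : Set where
  field
    matrix : Fin a → Fin b → ℤ
    rows   : ∀ i → ∑ℤ (matrix i) ≡ rowSum i
    cols   : ∀ j → ∑ℤ (λ i → matrix i j) ≡ colSum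
    ents   : entries matrix ↭ xs

reblock : ∀ {a b r r′ k k′ xs xs′} → (∀ i → r i ≡ r′ i) → k ≡ k′ → xs ↭ xs′ →
          Block a b r k xs → Block a b r′ k′ xs′
reblock r≡ k≡ p X = record
  { matrix = matrix
  ; rows   = λ i → ≡.trans (rows i) (r≡ i)
  ; cols   = λ j → ≡.trans (cols j) k≡
  ; ents   = ↭-trans ents p
  } where open Block X

hcat : ∀ {a b b′ r r′ k xs xs′} → Block a b r k xs → Block a b′ r′ k xs′ →
       Block a (b + b′) (λ i → r i +ᶻ r′ i) k (xs ++ xs′)
hcat {a} {b} {b′} {k = k} X Y = record
  { matrix = M
  ; rows   = λ i → ≡.trans (∑ℤ-↑ b (M i)) (cong₂ _+ᶻ_
      (≡.trans (∑ℤ-cong (left i)) (X.rows i)) (≡.trans (∑ℤ-cong (right i)) (Y.rows i)))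
  ; cols   = cols
  ; ents   = ↭-trans
      (concat-tabulate-↭ (λ i → ↭-reflexive (≡.trans (tabulate-+ b (M i))
        (cong₂ _++_ (tabulate-cong (left i)) (tabulate-cong (right i))))))
      (↭-trans (concat-tabulate-++ (λ i → tabulate (X.matrix i)) (λ i → tabulate (Y.matrix i)))
               (++⁺ X.ents Y.ents))
  }
  where
  module X = Block X
  module Y = Block Y
  M : Fin a → Fin (b + b′) → ℤ
  M i j = [ X.matrix i , Y.matrix i ]′ (splitAt b j)
  left : ∀ i j → M i (j ↑ˡ b′) ≡ X.matrix i j
  left i j = cong [ X.matrix i , Y.matrix i ]′ (splitAt-↑ˡ b j b′)
  right : ∀ i j → M i (b ↑ʳ j) ≡ Y.matrix i j
  right i j = cong [ X.matrix i , Y.matrix i ]′ (splitAt-↑ʳ b b′ j)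
  cols : ∀ j → ∑ℤ (λ i → M i j) ≡ k
  cols j with splitAt b j
  ... | inj₁ j′ = X.cols j′
  ... | inj₂ j′ = Y.cols j′

vcat : ∀ {a a′ b r k k′ xs xs′} → Block a b (const r) k xs → Block a′ b (const r) k′ xs′ →
       Block (a + a′) b (const r) (k +ᶻ k′) (xs ++ xs′)
vcat {a} {a′} {b} {r} X Y = record
  { matrix = M
  ; rows   = rows
  ; cols   = λ j → ≡.trans (∑ℤ-↑ a (λ i → M i j)) (cong₂ _+ᶻ_
      (≡.trans (∑ℤ-cong (λ i → ≡.cong-app (upper i) j)) (X.cols j))
      (≡.trans (∑ℤ-cong (λ i → ≡.cong-app (lower i) j)) (Y.cols j)))
  ; ents   = ↭-trans
      (↭-reflexive (≡.trans (cong concat (tabulate-+ a (λ i → tabulate (M i))))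
        (≡.trans (≡.sym (concat-++ (tabulate (λ i → tabulate (M (i ↑ˡ a′)))) _))
          (cong₂ _++_ (cong concat (tabulate-cong (cong tabulate ∘ upper)))
                      (cong concat (tabulate-cong (cong tabulate ∘ lower)))))))
      (++⁺ X.ents Y.ents)
  }
  where
  module X = Block X
  module Y = Block Y
  M : Fin (a + a′) → Fin b → ℤ
  M i = [ X.matrix , Y.matrix ]′ (splitAt a i)
  upper : ∀ i → M (i ↑ˡ a′) ≡ X.matrix i
  upper i = cong [ X.matrix , Y.matrix ]′ (splitAt-↑ˡ a i a′)
  lower : ∀ i → M (a ↑ʳ i) ≡ Y.matrix i
  lower i = cong [ X.matrix , Y.matrix ]′ (splitAt-↑ʳ a a′ i)
  rows : ∀ i → ∑ℤ (M i) ≡ r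
  rows i with splitAt a i
  ... | inj₁ i′ = X.rows i′
  ... | inj₂ i′ = Y.rows i′

flip-block : ∀ {a b r k xs} → Block a b (const r) k xs → Block b a (const k) r xs
flip-block X = record
  { matrix = flip matrix
  ; rows   = cols
  ; cols   = rows
  ; ents   = ↭-trans (entries-flip matrix) ents
  } where open Block X

fromVec : ∀ {a b} → Vec (Vec ℤ b) a → Fin a → Fin b → ℤ
fromVec v i j = Vec.lookup (Vec.lookup v i) j

-- Intervals of integers and the passage from blocks to magic rectangles

zrng : ℤ → ℕ → List ℤ
zrng z zero    = []
zrng z (suc n) = z ∷ zrng (1ℤ +ᶻ z) n

zrng-∷ʳ : ∀ z n → zrng z (suc n) ≡ zrng z n ++ [ + n +ᶻ z ]
zrng-∷ʳ z zero    = cong [_] (≡.sym (ℤ.+-identityˡ z))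
zrng-∷ʳ z (suc n) = cong (z ∷_) (≡.trans (zrng-∷ʳ (1ℤ +ᶻ z) n)
  (cong (λ y → zrng (1ℤ +ᶻ z) n ++ [ y ]) (lemma (+ n) z)))
  where
  lemma : ∀ n z → n +ᶻ (1ℤ +ᶻ z) ≡ (1ℤ +ᶻ n) +ᶻ z
  lemma = ℤ-Solver.solve-∀

map-∣+∣-zrng : ∀ c z x n → z +ᶻ c ≡ + x → map (λ y → ∣ y +ᶻ c ∣) (zrng z n) ≡ rng x n
map-∣+∣-zrng c z x zero    p = refl
map-∣+∣-zrng c z x (suc n) p = cong₂ _∷_ (cong ∣_∣ p)
  (map-∣+∣-zrng c (1ℤ +ᶻ z) (suc x) n (≡.trans (ℤ.+-assoc 1ℤ z c) (cong (1ℤ +ᶻ_) p)))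

zrng-nonneg : ∀ c z x n → z +ᶻ c ≡ + x → All (λ y → + ∣ y +ᶻ c ∣ ≡ y +ᶻ c) (zrng z n)
zrng-nonneg c z x zero    p = []
zrng-nonneg c z x (suc n) p = ≡.trans (cong (+_ ∘ ∣_∣) p) (≡.sym p) ∷
  zrng-nonneg c (1ℤ +ᶻ z) (suc x) n (≡.trans (ℤ.+-assoc 1ℤ z c) (cong (1ℤ +ᶻ_) p))

∑-∑ℤ : ∀ {n} c (f : Fin n → ℕ) (g : Fin n → ℤ) → (∀ i → + f i ≡ g i +ᶻ c) →
       + ∑ f ≡ ∑ℤ g +ᶻ + n *ᶻ c
∑-∑ℤ {zero}  c f g p = refl
∑-∑ℤ {suc n} c f g p = ≡.trans (cong₂ _+ᶻ_ (p zero) (∑-∑ℤ c (f ∘ suc) (g ∘ suc) (p ∘ suc)))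
  (lemma (g zero) c _ (+ n))
  where
  lemma : ∀ x c y n → (x +ᶻ c) +ᶻ (y +ᶻ n *ᶻ c) ≡ (x +ᶻ y) +ᶻ (1ℤ +ᶻ n) *ᶻ c
  lemma = ℤ-Solver.solve-∀

-- Adding `c` moves the interval starting at `z` to one starting at 1, so `∣_∣` loses nothing; every
-- row gains `b * c` and every column `a * c`.
block⇒magic : ∀ {a b r k z c} → z +ᶻ c ≡ 1ℤ → Block a b (const r) k (zrng z (a * b)) → Magic a b
block⇒magic {a} {b} {r} {k} {z} {c} z+c≡1 X = record
  { matrix = λ i j → ∣ matrix i j +ᶻ c ∣
  ; ρ      = ∣ r +ᶻ + b *ᶻ c ∣
  ; κ      = ∣ k +ᶻ + a *ᶻ c ∣
  ; rows   = λ i → cong ∣_∣ (≡.trans (∑-∑ℤ c _ (matrix i) (nonneg i)) (cong (_+ᶻ + b *ᶻ c) (rows i)))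
  ; cols   = λ j → cong ∣_∣ (≡.trans (∑-∑ℤ c _ (λ i → matrix i j) (flip nonneg j)) (cong (_+ᶻ + a *ᶻ c) (cols j)))
  ; ents   = ↭-trans (↭-reflexive (≡.sym (map-entries (λ y → ∣ y +ᶻ c ∣) matrix)))
      (↭-trans (map⁺ _ ents) (↭-reflexive (map-∣+∣-zrng c z 1 (a * b) z+c≡1)))
  }
  where
  open Block X
  nonneg : ∀ i j → + ∣ matrix i j +ᶻ c ∣ ≡ matrix i j +ᶻ c
  nonneg i j = All.lookup (zrng-nonneg c z 1 (a * b) z+c≡1) (Perm.∈-resp-↭ ents (∈-entries matrix i j))

rng-∷ʳ : ∀ x n → rng x (suc n) ≡ rng x n ++ [ n + x ]
rng-∷ʳ x n = ≡.trans (cong (rng x) (+-comm 1 n)) (rng-++ x n 1)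

-- Even-by-even rectangles.  The integer z stands for the half-integer z + 1/2.

-- `-ᶻ (+ suc x)` stands for the negative of `x + 1/2`. A line of `b` entries whose half-integers
-- cancel thus has integer sum `-b/2`; this explains the line sums of all tiles below.
halves : List ℕ → List ℤ
halves []       = []
halves (x ∷ xs) = + x ∷ -ᶻ (+ suc x) ∷ halves xs

halves-++ : ∀ xs ys → halves (xs ++ ys) ≡ halves xs ++ halves ys
halves-++ []       ys = refl
halves-++ (x ∷ xs) ys = cong (λ zs → + x ∷ -ᶻ (+ suc x) ∷ zs) (halves-++ xs ys)

halves-rng : ∀ n → halves (rng 0 n) ↭ zrng (-ᶻ (+ n)) (n * 2)
halves-rng zero    = ↭-refl
halves-rng (suc n) = begin
  halves (rng 0 (suc n))                                      ≡⟨ cong halves (rng-∷ʳ 0 n) ⟩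
  halves (rng 0 n ++ [ n + 0 ])                               ≡⟨ halves-++ (rng 0 n) _ ⟩
  halves (rng 0 n) ++ + (n + 0) ∷ -[1+ n + 0 ] ∷ []           ≡⟨ cong (λ m → halves (rng 0 n) ++ + m ∷ -[1+ m ] ∷ []) (+-identityʳ n) ⟩
  halves (rng 0 n) ++ + n ∷ -[1+ n ] ∷ []                     ↭⟨ ++⁺ʳ _ (halves-rng n) ⟩
  zrng (-ᶻ (+ n)) (n * 2) ++ + n ∷ -[1+ n ] ∷ []             ↭⟨ ++⁺ˡ (zrng _ (n * 2)) (swap (+ n) -[1+ n ] ↭-refl) ⟩
  zrng (-ᶻ (+ n)) (n * 2) ++ -[1+ n ] ∷ + n ∷ []             ↭⟨ shift -[1+ n ] (zrng _ (n * 2)) [ + n ] ⟩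
  -[1+ n ] ∷ zrng (-ᶻ (+ n)) (n * 2) ++ [ + n ]              ≡⟨ cong (λ y → -[1+ n ] ∷ zrng (-ᶻ (+ n)) (n * 2) ++ [ y ]) (last (+ n) (cong +_ (*-comm n 2))) ⟩
  -[1+ n ] ∷ zrng (-ᶻ (+ n)) (n * 2) ++ [ + (n * 2) +ᶻ -ᶻ (+ n) ] ≡⟨ cong (-[1+ n ] ∷_) (zrng-∷ʳ (-ᶻ (+ n)) (n * 2)) ⟨
  -[1+ n ] ∷ zrng (-ᶻ (+ n)) (suc (n * 2))                   ≡⟨ cong (λ y → -[1+ n ] ∷ zrng y (suc (n * 2))) (first (+ n)) ⟩
  -[1+ n ] ∷ zrng (1ℤ +ᶻ -[1+ n ]) (suc (n * 2)) ∎
  where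
  open PermutationReasoning
  first : ∀ n → -ᶻ n ≡ 1ℤ +ᶻ -ᶻ (1ℤ +ᶻ n)
  first = ℤ-Solver.solve-∀
  lemma : ∀ n → n ≡ (n +ᶻ (n +ᶻ 0ℤ)) +ᶻ -ᶻ n
  lemma = ℤ-Solver.solve-∀
  last : ∀ n {m} → m ≡ n +ᶻ (n +ᶻ 0ℤ) → n ≡ m +ᶻ -ᶻ n
  last n refl = lemma n

-- The signs +, -, -, + make four consecutive half-integers cancel, and the second row negates the
-- first.
tile-2×4 : ∀ x → Block 2 4 (const (-ᶻ (+ 2))) (-ᶻ (+ 1)) (halves (rng x 4))
tile-2×4 x = record
  { matrix = fromVec
      ( (+ x                 ∷ -ᶻ (+ (2 + x)) ∷ -ᶻ (+ (3 + x)) ∷ + (3 + x)         ∷ [])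
      ∷ (-ᶻ (+ (1 + x))     ∷ + (1 + x)       ∷ + (2 + x)       ∷ -ᶻ (+ (4 + x))   ∷ []) ∷ [])
  ; rows   = λ { zero → r₀ (+ x) ; (suc zero) → r₁ (+ x) }
  ; cols   = λ { zero → c₀ (+ x) ; (suc zero) → c₁ (+ x) ; (suc (suc zero)) → c₂ (+ x) ; (suc (suc (suc zero))) → c₃ (+ x) }
  ; ents   = select-↭ (halves (rng x 4)) (# 0 ∷ # 3 ∷ # 5 ∷ # 6 ∷ # 1 ∷ # 2 ∷ # 4 ∷ # 7 ∷ [])
  }
  where
  r₀ : ∀ x → x +ᶻ (-ᶻ (+ 2 +ᶻ x) +ᶻ (-ᶻ (+ 3 +ᶻ x) +ᶻ ((+ 3 +ᶻ x) +ᶻ 0ℤ))) ≡ -ᶻ (+ 2)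
  r₀ = ℤ-Solver.solve-∀
  r₁ : ∀ x → -ᶻ (+ 1 +ᶻ x) +ᶻ ((+ 1 +ᶻ x) +ᶻ ((+ 2 +ᶻ x) +ᶻ (-ᶻ (+ 4 +ᶻ x) +ᶻ 0ℤ))) ≡ -ᶻ (+ 2)
  r₁ = ℤ-Solver.solve-∀
  c₀ : ∀ x → x +ᶻ (-ᶻ (+ 1 +ᶻ x) +ᶻ 0ℤ) ≡ -ᶻ (+ 1)
  c₀ = ℤ-Solver.solve-∀
  c₁ : ∀ x → -ᶻ (+ 2 +ᶻ x) +ᶻ ((+ 1 +ᶻ x) +ᶻ 0ℤ) ≡ -ᶻ (+ 1)
  c₁ = ℤ-Solver.solve-∀
  c₂ : ∀ x → -ᶻ (+ 3 +ᶻ x) +ᶻ ((+ 2 +ᶻ x) +ᶻ 0ℤ) ≡ -ᶻ (+ 1)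
  c₂ = ℤ-Solver.solve-∀
  c₃ : ∀ x → (+ 3 +ᶻ x) +ᶻ (-ᶻ (+ 4 +ᶻ x) +ᶻ 0ℤ) ≡ -ᶻ (+ 1)
  c₃ = ℤ-Solver.solve-∀

-- The signs in each column come from 11 + 7 = 1 + 3 + 5 + 9.
tile-6×2 : Block 6 2 (const (-ᶻ (+ 1))) (-ᶻ (+ 3)) (halves (rng 0 6))
tile-6×2 = record
  { matrix = fromVec
      ( (+ 5 ∷ -ᶻ (+ 6) ∷ []) ∷ (+ 3 ∷ -ᶻ (+ 4) ∷ []) ∷ (-ᶻ (+ 1) ∷ + 0 ∷ [])
      ∷ (-ᶻ (+ 2) ∷ + 1 ∷ []) ∷ (-ᶻ (+ 3) ∷ + 2 ∷ []) ∷ (-ᶻ (+ 5) ∷ + 4 ∷ []) ∷ [])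
  ; rows   = λ { zero → refl ; (suc zero) → refl ; (suc (suc zero)) → refl
               ; (suc (suc (suc zero))) → refl ; (suc (suc (suc (suc zero)))) → refl
               ; (suc (suc (suc (suc (suc zero))))) → refl }
  ; cols   = λ { zero → refl ; (suc zero) → refl }
  ; ents   = select-↭ (halves (rng 0 6))
      (# 10 ∷ # 11 ∷ # 6 ∷ # 7 ∷ # 1 ∷ # 0 ∷ # 3 ∷ # 2 ∷ # 5 ∷ # 4 ∷ # 9 ∷ # 8 ∷ [])
  }

halves-rng-++ : ∀ x m n → halves (rng x m) ++ halves (rng (m + x) n) ↭ halves (rng x (m + n))
halves-rng-++ x m n = ↭-reflexive (≡.trans (≡.sym (halves-++ (rng x m) _))
  (cong halves (≡.sym (rng-++ x m n))))

neg-+ : ∀ m n → -ᶻ (+ m) +ᶻ -ᶻ (+ n) ≡ -ᶻ (+ (m + n))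
neg-+ m n = ≡.sym (ℤ.neg-distrib-+ (+ m) (+ n))

strip-2 : ∀ j x → Block 2 (j * 2 * 2) (const (-ᶻ (+ (j * 2)))) (-ᶻ (+ 1)) (halves (rng x (j * 2 * 2)))
strip-2 zero    x = record { matrix = λ _ () ; rows = λ { zero → refl ; (suc zero) → refl } ; cols = λ () ; ents = ↭-refl }
strip-2 (suc j) x = reblock (λ _ → neg-+ 2 (j * 2)) refl (halves-rng-++ x 4 (j * 2 * 2))
  (hcat (tile-2×4 x) (strip-2 j (4 + x)))

even-×4 : ∀ a j x → Block (a * 2) (j * 2 * 2) (const (-ᶻ (+ (j * 2)))) (-ᶻ (+ a)) (halves (rng x (a * (j * 2 * 2))))
even-×4 zero    j x = record { matrix = λ () ; rows = λ () ; cols = λ _ → refl ; ents = ↭-refl }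
even-×4 (suc a) j x = reblock (λ _ → refl) (neg-+ 1 a) (halves-rng-++ x (j * 2 * 2) (a * (j * 2 * 2)))
  (vcat (strip-2 j x) (even-×4 a j (j * 2 * 2 + x)))

4-×2 : ∀ a x → Block (a * 2 * 2) 2 (const (-ᶻ (+ 1))) (-ᶻ (+ (a * 2))) (halves (rng x (a * 2 * 2)))
4-×2 a x = flip-block (strip-2 a x)

halves⇒magic : ∀ {a b r k} h → h * 2 ≡ a * b → Block a b (const r) k (halves (rng 0 h)) → Magic a b
halves⇒magic {a} {b} h h*2≡ab X = block⇒magic {z = -ᶻ (+ h)} {c = + suc h} (lemma (+ h))
  (reblock (λ _ → refl) refl (subst (λ n → halves (rng 0 h) ↭ zrng (-ᶻ (+ h)) n) h*2≡ab (halves-rng h)) X)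
  where
  lemma : ∀ h → -ᶻ h +ᶻ (1ℤ +ᶻ h) ≡ 1ℤ
  lemma = ℤ-Solver.solve-∀

magic-≡ : ∀ {a a′ b b′} → a ≡ a′ → b ≡ b′ → Magic a b → Magic a′ b′
magic-≡ refl refl X = X

magic-even-2+4 : ∀ a j {k} → Block (a * 2) 2 (const (-ᶻ (+ 1))) k (halves (rng 0 (a * 2))) →
                 k ≡ -ᶻ (+ a) → Magic (a * 2) (2 + j * 2 * 2)
magic-even-2+4 a j X refl = halves⇒magic (a * 2 + a * (j * 2 * 2)) (lemma a j)
  (reblock (λ _ → refl) refl (halves-rng-++ 0 (a * 2) (a * (j * 2 * 2)))
    (hcat X (even-×4 a j (a * 2 + 0))))
  where
  lemma : ∀ a j → (a * 2 + a * (j * 2 * 2)) * 2 ≡ a * 2 * (2 + j * 2 * 2)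
  lemma = ℕ-Solver.solve-∀

parity : ∀ n → (∃[ m ] n ≡ m * 2) ⊎ (∃[ m ] n ≡ 1 + m * 2)
parity zero = inj₁ (0 , refl)
parity (suc n) with parity n
... | inj₁ (m , refl) = inj₂ (m , refl)
... | inj₂ (m , refl) = inj₁ (suc m , refl)

-- If `b` is odd, the width is 2 modulo 4 and two columns remain besides the 2 x 4 tiles. Transposed
-- tiles fill them when `a` is even; otherwise the 6 x 2 tile corrects the height. It fits because
-- `1 ≤ b < a` rules out `a = 1`.
magic-even : ∀ a b → 1 ≤ b → b < a → Magic (a * 2) (b * 2)
magic-even a b 1≤b b<a with parity b | parity a
... | inj₁ (j , refl) | _ = halves⇒magic (a * (j * 2 * 2)) (lemma a j) (even-×4 a j 0)
  where
  lemma : ∀ a j → a * (j * 2 * 2) * 2 ≡ a * 2 * (j * 2 * 2)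
  lemma = ℕ-Solver.solve-∀
... | inj₂ (j , refl) | inj₁ (m , refl) = magic-even-2+4 (m * 2) j (4-×2 m 0) refl
... | inj₂ (j , refl) | inj₂ (zero , refl) with s≤s () ← b<a
... | inj₂ (j , refl) | inj₂ (suc m , refl) = magic-even-2+4 (3 + m * 2) j
        (reblock (λ _ → refl) (neg-+ 3 (m * 2)) (halves-rng-++ 0 6 (m * 2 * 2)) (vcat tile-6×2 (4-×2 m 6))) refl

-- Centred entries for an odd number of cells

signed : List ℕ → List ℤ
signed []       = []
signed (x ∷ xs) = + x ∷ -ᶻ (+ x) ∷ signed xs

signed-++ : ∀ xs ys → signed (xs ++ ys) ≡ signed xs ++ signed ys
signed-++ []       ys = refl
signed-++ (x ∷ xs) ys = cong (λ zs → + x ∷ -ᶻ (+ x) ∷ zs) (signed-++ xs ys)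

signed-↭ : ∀ {xs ys} → xs ↭ ys → signed xs ↭ signed ys
signed-↭ refl           = ↭-refl
signed-↭ (prep x p)     = prep _ (prep _ (signed-↭ p))
signed-↭ (swap x y p)   = ↭-trans (shifts (+ x ∷ -ᶻ (+ x) ∷ []) (+ y ∷ -ᶻ (+ y) ∷ []))
  (prep _ (prep _ (prep _ (prep _ (signed-↭ p)))))
signed-↭ (trans p q)    = ↭-trans (signed-↭ p) (signed-↭ q)

signed-rng : ∀ n → 0ℤ ∷ signed (rng 1 n) ↭ zrng (-ᶻ (+ n)) (1 + n * 2)
signed-rng zero    = ↭-refl
signed-rng (suc n) = begin
  0ℤ ∷ signed (rng 1 (suc n))                                      ≡⟨ cong (λ xs → 0ℤ ∷ signed xs) (rng-∷ʳ 1 n) ⟩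
  0ℤ ∷ signed (rng 1 n ++ [ n + 1 ])                               ≡⟨ cong (0ℤ ∷_) (signed-++ (rng 1 n) _) ⟩
  0ℤ ∷ signed (rng 1 n) ++ + (n + 1) ∷ -ᶻ (+ (n + 1)) ∷ []         ≡⟨ cong (λ m → 0ℤ ∷ signed (rng 1 n) ++ + m ∷ -ᶻ (+ m) ∷ []) (+-comm n 1) ⟩
  0ℤ ∷ signed (rng 1 n) ++ + suc n ∷ -[1+ n ] ∷ []                 ↭⟨ ++⁺ʳ _ (signed-rng n) ⟩
  zrng (-ᶻ (+ n)) (1 + n * 2) ++ + suc n ∷ -[1+ n ] ∷ []           ↭⟨ ++⁺ˡ (zrng _ (1 + n * 2)) (swap (+ suc n) -[1+ n ] ↭-refl) ⟩
  zrng (-ᶻ (+ n)) (1 + n * 2) ++ -[1+ n ] ∷ + suc n ∷ []           ↭⟨ shift -[1+ n ] (zrng _ (1 + n * 2)) [ + suc n ] ⟩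
  -[1+ n ] ∷ zrng (-ᶻ (+ n)) (1 + n * 2) ++ [ + suc n ]            ≡⟨ cong (λ y → -[1+ n ] ∷ zrng (-ᶻ (+ n)) (1 + n * 2) ++ [ y ]) (last (+ n) (cong +_ (*-comm n 2))) ⟩
  -[1+ n ] ∷ zrng (-ᶻ (+ n)) (1 + n * 2) ++ [ + (1 + n * 2) +ᶻ -ᶻ (+ n) ] ≡⟨ cong (-[1+ n ] ∷_) (zrng-∷ʳ (-ᶻ (+ n)) (1 + n * 2)) ⟨
  -[1+ n ] ∷ zrng (-ᶻ (+ n)) (2 + n * 2)                           ≡⟨ cong (λ y → -[1+ n ] ∷ zrng y (2 + n * 2)) (first (+ n)) ⟩
  -[1+ n ] ∷ zrng (1ℤ +ᶻ -[1+ n ]) (2 + n * 2) ∎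
  where
  open PermutationReasoning
  first : ∀ n → -ᶻ n ≡ 1ℤ +ᶻ -ᶻ (1ℤ +ᶻ n)
  first = ℤ-Solver.solve-∀
  lemma : ∀ n → 1ℤ +ᶻ n ≡ (1ℤ +ᶻ (n +ᶻ (n +ᶻ 0ℤ))) +ᶻ -ᶻ n
  lemma = ℤ-Solver.solve-∀
  last : ∀ n {m} → m ≡ n +ᶻ (n +ᶻ 0ℤ) → 1ℤ +ᶻ n ≡ (1ℤ +ᶻ m) +ᶻ -ᶻ n
  last n refl = lemma n

signed⇒magic : ∀ {a b r k} h → 1 + h * 2 ≡ a * b → Block a b (const r) k (0ℤ ∷ signed (rng 1 h)) → Magic a b
signed⇒magic {a} {b} h eq X = block⇒magic {z = -ᶻ (+ h)} {c = + suc h} (lemma (+ h))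
  (reblock (λ _ → refl) refl (subst (λ n → 0ℤ ∷ signed (rng 1 h) ↭ zrng (-ᶻ (+ h)) n) eq (signed-rng h)) X)
  where
  lemma : ∀ h → -ᶻ h +ᶻ (1ℤ +ᶻ h) ≡ 1ℤ
  lemma = ℤ-Solver.solve-∀

-- Odd Graeco-Latin squares

sumℤ-↭ : ∀ {xs ys} → xs ↭ ys → sumℤ xs ≡ sumℤ ys
sumℤ-↭ refl         = refl
sumℤ-↭ (prep x p)   = cong (x +ᶻ_) (sumℤ-↭ p)
sumℤ-↭ (swap {xs} x y p) = ≡.trans (lemma x y (sumℤ xs)) (cong (λ z → y +ᶻ (x +ᶻ z)) (sumℤ-↭ p))
  where
  lemma : ∀ x y z → x +ᶻ (y +ᶻ z) ≡ y +ᶻ (x +ᶻ z)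
  lemma = ℤ-Solver.solve-∀
sumℤ-↭ (trans p q)  = ≡.trans (sumℤ-↭ p) (sumℤ-↭ q)

∑ℤ-+ : ∀ {n} (f g : Fin n → ℤ) → ∑ℤ (λ i → f i +ᶻ g i) ≡ ∑ℤ f +ᶻ ∑ℤ g
∑ℤ-+ {zero}  f g = refl
∑ℤ-+ {suc n} f g = ≡.trans (cong (f zero +ᶻ g zero +ᶻ_) (∑ℤ-+ (f ∘ suc) (g ∘ suc)))
  (lemma (f zero) (g zero) _ _)
  where
  lemma : ∀ x y z w → (x +ᶻ y) +ᶻ (z +ᶻ w) ≡ (x +ᶻ z) +ᶻ (y +ᶻ w)
  lemma = ℤ-Solver.solve-∀

module Cyclic (S : ℕ) where

  s : ℕ
  s = 1 + S * 2

  infixl 6 _⊕_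
  _⊕_ : Fin s → Fin s → Fin s
  i ⊕ j = (toℕ i + toℕ j) mod s

  toℕ-⊕ : ∀ i j → toℕ (i ⊕ j) ≡ (toℕ i + toℕ j) % s
  toℕ-⊕ i j = toℕ-fromℕ< _

  %-cancel : ∀ m n → (m + n) % s ≡ m % s → s ∣ n
  %-cancel m n eq = ∣m+n∣m⇒∣n {m = (m / s) * s} {n = n} (divides ((m + n) / s) (+-cancelˡ-≡ (m % s) _ _ (begin
      m % s + (m / s * s + n)            ≡⟨ +-assoc (m % s) _ n ⟨
      m % s + m / s * s + n              ≡⟨ cong (_+ n) (m≡m%n+[m/n]*n m s) ⟨
      m + n                              ≡⟨ m≡m%n+[m/n]*n (m + n) s ⟩
      (m + n) % s + (m + n) / s * s      ≡⟨ cong (_+ (m + n) / s * s) eq ⟩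
      m % s + (m + n) / s * s            ∎)))
      (n∣m*n (m / s))
    where open ≡.≡-Reasoning

  s∤ : ∀ {d} → d < s → s ∣ d → d ≡ 0
  s∤ d<s (divides zero    refl) = refl
  s∤ d<s (divides (suc q) refl) = contradiction d<s (≤⇒≯ (m≤m+n s (q * s)))

  -- Two is invertible modulo the odd number `s`: as `2 * d < 2 * s`, a nonzero multiple of `s`
  -- could only be `s` itself, which is odd.
  s∤2* : ∀ {d} → d < s → s ∣ 2 * d → d ≡ 0
  s∤2* {zero}  d<s _ = refl
  s∤2* {suc d} d<s (divides zero ())
  s∤2* {d} d<s (divides (suc zero) eq) = contradiction (≡.trans eq (≡.trans (+-identityʳ s) (cong suc (*-comm S 2)))) (even≢odd d S)
  s∤2* {d} d<s (divides (suc (suc q)) eq) = contradiction (begin-strict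
      2 * d             <⟨ *-monoʳ-< 2 d<s ⟩
      2 * s             ≤⟨ *-monoˡ-≤ s (s≤s (s≤s (z≤n {q}))) ⟩
      (2 + q) * s       ≡⟨ eq ⟨
      2 * d             ∎) (<-irrefl refl)
    where open ≤-Reasoning

  module _ (m : ℕ) (inv : ∀ {d} → d < s → s ∣ m * d → d ≡ 0) (c : ℕ) where

    affine-injective-≤ : ∀ {x y} → x ≤ y → y < s → (c + m * y) % s ≡ (c + m * x) % s → x ≡ y
    affine-injective-≤ {x} {y} x≤y y<s eq = ≤-antisym x≤y (m∸n≡0⇒m≤n (inv (≤-<-trans (m∸n≤m y x) y<s)
      (%-cancel (c + m * x) (m * (y ∸ x)) (≡.trans (cong (_% s) sum≡) eq))))
      where
      sum≡ : c + m * x + m * (y ∸ x) ≡ c + m * y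
      sum≡ = ≡.trans (+-assoc c _ _) (cong (λ z → c + z)
        (≡.trans (≡.sym (*-distribˡ-+ m x _)) (cong (m *_) (m+[n∸m]≡n x≤y))))

    affine-injective : ∀ {x y} → x < s → y < s → (c + m * x) % s ≡ (c + m * y) % s → x ≡ y
    affine-injective {x} {y} x<s y<s eq with ≤-total x y
    ... | inj₁ x≤y = affine-injective-≤ x≤y y<s (≡.sym eq)
    ... | inj₂ y≤x = ≡.sym (affine-injective-≤ y≤x x<s eq)

  ⊕-injectiveʳ : ∀ i → Injective _≡_ _≡_ (i ⊕_)
  ⊕-injectiveʳ i {j} {k} eq = toℕ-injective (affine-injective 1 (λ d<s → s∤ d<s ∘ subst (s ∣_) (*-identityˡ _))
    (toℕ i) (toℕ<n j) (toℕ<n k) (≡.trans (value j) (≡.trans (cong toℕ eq) (≡.sym (value k)))))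
    where
    value : ∀ j → (toℕ i + 1 * toℕ j) % s ≡ toℕ (i ⊕ j)
    value j = ≡.trans (cong (λ x → (toℕ i + x) % s) (*-identityˡ (toℕ j))) (≡.sym (toℕ-⊕ i j))

  ⊕-comm : ∀ i j → i ⊕ j ≡ j ⊕ i
  ⊕-comm i j = cong (_mod s) (+-comm (toℕ i) (toℕ j))

  ⊕-injectiveˡ : ∀ j → Injective _≡_ _≡_ (_⊕ j)
  ⊕-injectiveˡ j {i} {k} eq = ⊕-injectiveʳ j (≡.trans (⊕-comm j i) (≡.trans eq (⊕-comm k j)))

  ⊕-⊕-injective : ∀ i → Injective _≡_ _≡_ (λ j → i ⊕ j ⊕ j)
  ⊕-⊕-injective i {j} {k} eq = toℕ-injective (affine-injective 2 s∤2* (toℕ i) (toℕ<n j) (toℕ<n k)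
    (≡.trans (value j) (≡.trans (cong toℕ eq) (≡.sym (value k)))))
    where
    value : ∀ j → (toℕ i + 2 * toℕ j) % s ≡ toℕ (i ⊕ j ⊕ j)
    value j = begin
      (toℕ i + 2 * toℕ j) % s                          ≡⟨ cong (_% s) (lemma (toℕ i) (toℕ j)) ⟩
      (toℕ i + toℕ j + toℕ j) % s                      ≡⟨ %-distribˡ-+ (toℕ i + toℕ j) (toℕ j) s ⟩
      ((toℕ i + toℕ j) % s + toℕ j % s) % s            ≡⟨ cong (λ x → (x + toℕ j % s) % s) (m%n%n≡m%n (toℕ i + toℕ j) s) ⟨
      ((toℕ i + toℕ j) % s % s + toℕ j % s) % s        ≡⟨ %-distribˡ-+ ((toℕ i + toℕ j) % s) (toℕ j) s ⟨
      ((toℕ i + toℕ j) % s + toℕ j) % s                ≡⟨ cong (λ x → (x + toℕ j) % s) (toℕ-⊕ i j) ⟨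
      (toℕ (i ⊕ j) + toℕ j) % s                        ≡⟨ toℕ-⊕ (i ⊕ j) j ⟨
      toℕ (i ⊕ j ⊕ j)                                  ∎
      where
      open ≡.≡-Reasoning
      lemma : ∀ i j → i + 2 * j ≡ i + j + j
      lemma = ℕ-Solver.solve-∀

  -- `i ⊕ j` and `i ⊕ j ⊕ j` are orthogonal Latin squares. In every line both run through all
  -- residues, so `α` and `γ` cancel separately. Orthogonality is shown by two substitutions:
  -- `u = i ⊕ j` for fixed `j`, and `v = u ⊕ j` for fixed `u`.
  latin : (α γ : Fin s → ℤ) → ∑ℤ α ≡ 0ℤ → ∑ℤ γ ≡ 0ℤ →
          Block s s (const 0ℤ) 0ℤ (entries (λ u v → α u +ᶻ γ v))
  latin α γ ∑α ∑γ = record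
    { matrix = λ i j → F (i ⊕ j) (i ⊕ j ⊕ j)
    ; rows   = λ i → line (⊕-injectiveʳ i) (⊕-⊕-injective i)
    ; cols   = λ j → line (⊕-injectiveˡ j) (⊕-injectiveˡ j ∘ ⊕-injectiveˡ j)
    ; ents   = begin
        entries (λ i j → F (i ⊕ j) (i ⊕ j ⊕ j))   ↭⟨ entries-flip (λ i j → F (i ⊕ j) (i ⊕ j ⊕ j)) ⟨
        entries (λ j i → F (i ⊕ j) (i ⊕ j ⊕ j))   ↭⟨ concat-tabulate-↭ (λ j → tabulate-∘-injective (λ u → F u (u ⊕ j)) (⊕-injectiveˡ j)) ⟩
        entries (λ j u → F u (u ⊕ j))             ↭⟨ entries-flip (λ u j → F u (u ⊕ j)) ⟩
        entries (λ u j → F u (u ⊕ j))             ↭⟨ concat-tabulate-↭ (λ u → tabulate-∘-injective (F u) (⊕-injectiveʳ u)) ⟩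
        entries F                                 ∎
    }
    where
    open PermutationReasoning
    F : Fin s → Fin s → ℤ
    F u v = α u +ᶻ γ v
    line : ∀ {f g : Fin s → Fin s} → Injective _≡_ _≡_ f → Injective _≡_ _≡_ g →
           ∑ℤ (λ i → F (f i) (g i)) ≡ 0ℤ
    line {f} {g} f-inj g-inj = ≡.trans (∑ℤ-+ (α ∘ f) (γ ∘ g))
      (cong₂ _+ᶻ_ (≡.trans (sumℤ-↭ (tabulate-∘-injective α f-inj)) ∑α)
                  (≡.trans (sumℤ-↭ (tabulate-∘-injective γ g-inj)) ∑γ))

signedVec : ∀ {n} → Vec ℕ n → Vec ℤ (n * 2)
signedVec []       = []
signedVec (x ∷ xs) = + x ∷ -ᶻ (+ x) ∷ signedVec xs

toList-signedVec : ∀ {n} (xs : Vec ℕ n) → Vec.toList (signedVec xs) ≡ signed (Vec.toList xs)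
toList-signedVec []       = refl
toList-signedVec (x ∷ xs) = cong (λ ys → + x ∷ -ᶻ (+ x) ∷ ys) (toList-signedVec xs)

tabulate-lookup-vec : ∀ {n} (xs : Vec A n) → tabulate (Vec.lookup xs) ≡ Vec.toList xs
tabulate-lookup-vec []       = refl
tabulate-lookup-vec (x ∷ xs) = cong (x ∷_) (tabulate-lookup-vec xs)

sumℤ-signed : ∀ xs → sumℤ (signed xs) ≡ 0ℤ
sumℤ-signed []       = refl
sumℤ-signed (x ∷ xs) = ≡.trans (cong (λ z → + x +ᶻ (-ᶻ (+ x) +ᶻ z)) (sumℤ-signed xs)) (lemma (+ x))
  where
  lemma : ∀ x → x +ᶻ (-ᶻ x +ᶻ 0ℤ) ≡ 0ℤ
  lemma = ℤ-Solver.solve-∀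

rngVec : ℕ → ∀ n → Vec ℕ n
rngVec x zero    = []
rngVec x (suc n) = x ∷ rngVec (suc x) n

toList-rngVec : ∀ x n → Vec.toList (rngVec x n) ≡ rng x n
toList-rngVec x zero    = refl
toList-rngVec x (suc n) = cong (x ∷_) (toList-rngVec (suc x) n)

intervals : ∀ {n} → ℕ → Vec ℕ n → List ℕ
intervals w []       = []
intervals w (l ∷ ls) = rng l w ++ intervals w ls

signed-halves : ∀ xs → map +_ xs ++ map (λ x → -ᶻ (+ x)) xs ↭ signed xs
signed-halves []       = ↭-refl
signed-halves (x ∷ xs) = prep (+ x) (↭-trans (shift (-ᶻ (+ x)) (map +_ xs) _) (prep _ (signed-halves xs)))

map-neg-signed : ∀ xs → map -ᶻ_ (signed xs) ↭ signed xs
map-neg-signed []       = ↭-refl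
map-neg-signed (x ∷ xs) = ↭-trans (swap _ _ (map-neg-signed xs))
  (↭-reflexive (cong (λ y → y ∷ -ᶻ (+ x) ∷ signed xs) (ℤ.neg-involutive (+ x))))

map-+-zrng : ∀ c z x n → c +ᶻ z ≡ + x → map (c +ᶻ_) (zrng z n) ≡ map +_ (rng x n)
map-+-zrng c z x zero    p = refl
map-+-zrng c z x (suc n) p = cong₂ _∷_ p (map-+-zrng c (1ℤ +ᶻ z) (suc x) n
  (≡.trans (lemma c z) (cong (1ℤ +ᶻ_) p)))
  where
  lemma : ∀ c z → c +ᶻ (1ℤ +ᶻ z) ≡ 1ℤ +ᶻ (c +ᶻ z)
  lemma = ℤ-Solver.solve-∀

module Core (S : ℕ) where
  open Cyclic S

  base : List ℤ
  base = 0ℤ ∷ signed (rng 1 S)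

  interval⁺ : ∀ l → map (+ (l + S) +ᶻ_) base ↭ map +_ (rng l s)
  interval⁺ l = ↭-trans (map⁺ _ (signed-rng S)) (↭-reflexive (map-+-zrng (+ (l + S)) (-ᶻ (+ S)) l s (lemma (+ l) (+ S))))
    where
    lemma : ∀ l s → (l +ᶻ s) +ᶻ -ᶻ s ≡ l
    lemma = ℤ-Solver.solve-∀

  interval⁻ : ∀ l → map (-ᶻ (+ (l + S)) +ᶻ_) base ↭ map (λ x → -ᶻ (+ x)) (rng l s)
  interval⁻ l = begin
    map (-ᶻ c +ᶻ_) base                         ↭⟨ map⁺ _ (prep 0ℤ (map-neg-signed (rng 1 S))) ⟨
    map (-ᶻ c +ᶻ_) (map -ᶻ_ base)               ≡⟨ map-∘ base ⟨
    map (λ g → -ᶻ c +ᶻ -ᶻ g) base               ≡⟨ map-cong (λ g → ℤ.neg-distrib-+ c g) base ⟨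
    map (λ g → -ᶻ (c +ᶻ g)) base                ≡⟨ map-∘ base ⟩
    map -ᶻ_ (map (c +ᶻ_) base)                  ↭⟨ map⁺ -ᶻ_ (interval⁺ l) ⟩
    map -ᶻ_ (map +_ (rng l s))                  ≡⟨ map-∘ (rng l s) ⟨
    map (λ x → -ᶻ (+ x)) (rng l s)              ∎
    where
    open PermutationReasoning
    c = + (l + S)

  translates : ∀ {n} (ls : Vec ℕ n) →
    concat (map (λ c → map (c +ᶻ_) base) (Vec.toList (signedVec (Vec.map (_+ S) ls)))) ↭ signed (intervals s ls)
  translates []       = ↭-refl
  translates (l ∷ ls) = begin
    map (c +ᶻ_) base ++ map (-ᶻ c +ᶻ_) base ++ rest        ↭⟨ Perm.++-assoc (map (c +ᶻ_) base) _ rest ⟨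
    (map (c +ᶻ_) base ++ map (-ᶻ c +ᶻ_) base) ++ rest      ↭⟨ ++⁺ (++⁺ (interval⁺ l) (interval⁻ l)) (translates ls) ⟩
    (map +_ (rng l s) ++ map (λ x → -ᶻ (+ x)) (rng l s)) ++ signed (intervals s ls) ↭⟨ ++⁺ʳ _ (signed-halves (rng l s)) ⟩
    signed (rng l s) ++ signed (intervals s ls)            ≡⟨ signed-++ (rng l s) _ ⟨
    signed (rng l s ++ intervals s ls)                     ∎
    where
    open PermutationReasoning
    c = + (l + S)
    rest = concat (map (λ c → map (c +ᶻ_) base) (Vec.toList (signedVec (Vec.map (_+ S) ls))))

  -- `γ` runs through `[-S, S]`, and each value of `α`, namely 0 or plus or minus `l + S`,
  -- translates that interval. The symmetry of these values alone makes `α` sum to zero, so the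
  -- starts `ls` are free and can be adapted to the rows added later.
  core : (ls : Vec ℕ S) → Block s s (const 0ℤ) 0ℤ (0ℤ ∷ signed (rng 1 S ++ intervals s ls))
  core ls = reblock (λ _ → refl) refl perm (latin (Vec.lookup αs) (Vec.lookup γs)
      (≡.trans (cong sumℤ tabα) (≡.trans (ℤ.+-identityˡ _) (≡.trans (cong sumℤ (toList-signedVec centres)) (sumℤ-signed (Vec.toList centres)))))
      (≡.trans (cong sumℤ tabγ) (≡.trans (ℤ.+-identityˡ _) (sumℤ-signed (rng 1 S)))))
    where
    centres = Vec.map (_+ S) ls
    αs = 0ℤ ∷ signedVec centres
    γs = 0ℤ ∷ signedVec (rngVec 1 S)
    tabα : tabulate (Vec.lookup αs) ≡ 0ℤ ∷ Vec.toList (signedVec centres)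
    tabα = tabulate-lookup-vec αs
    tabγ : tabulate (Vec.lookup γs) ≡ base
    tabγ = ≡.trans (tabulate-lookup-vec γs) (cong (0ℤ ∷_) (≡.trans (toList-signedVec (rngVec 1 S)) (cong signed (toList-rngVec 1 S))))
    open PermutationReasoning
    translate : ℤ → List ℤ
    translate c = map (c +ᶻ_) base
    perm : entries (λ u v → Vec.lookup αs u +ᶻ Vec.lookup γs v) ↭ 0ℤ ∷ signed (rng 1 S ++ intervals s ls)
    perm = begin
      entries (λ u v → Vec.lookup αs u +ᶻ Vec.lookup γs v)
        ≡⟨ cong concat (tabulate-cong (λ u → ≡.trans (≡.sym (map-tabulate (Vec.lookup γs) (Vec.lookup αs u +ᶻ_))) (cong (map (Vec.lookup αs u +ᶻ_)) tabγ))) ⟩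
      concat (tabulate (translate ∘ Vec.lookup αs))
        ≡⟨ cong concat (map-tabulate (Vec.lookup αs) translate) ⟨
      concat (map translate (tabulate (Vec.lookup αs)))
        ≡⟨ cong (concat ∘ map translate) tabα ⟩
      translate 0ℤ ++ concat (map translate (Vec.toList (signedVec centres)))
        ≡⟨ cong (_++ concat (map translate (Vec.toList (signedVec centres)))) (≡.trans (map-cong ℤ.+-identityˡ base) (map-id base)) ⟩
      base ++ concat (map translate (Vec.toList (signedVec centres)))
        ↭⟨ ++⁺ˡ base (translates ls) ⟩
      base ++ signed (intervals s ls)
        ≡⟨ cong (0ℤ ∷_) (signed-++ (rng 1 S) _) ⟨
      0ℤ ∷ signed (rng 1 S ++ intervals s ls) ∎

-- Pairs of opposite rows

±_ : ℤ → Fin 2 → ℤ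
(± k) zero       = k
(± k) (suc zero) = -ᶻ k

pairs : ∀ {n} → Vec ℕ n → List ℕ
pairs []       = []
pairs (w ∷ ws) = w ∷ suc w ∷ pairs ws

pairs-++ : ∀ {m n} (us : Vec ℕ m) (vs : Vec ℕ n) → pairs (us Vec.++ vs) ≡ pairs us ++ pairs vs
pairs-++ []       vs = refl
pairs-++ (u ∷ us) vs = cong (λ xs → u ∷ suc u ∷ xs) (pairs-++ us vs)

unit-tile : ∀ w → Block 2 2 (± 1ℤ) 0ℤ (signed (w ∷ suc w ∷ []))
unit-tile w = record
  { matrix = fromVec ((+ suc w ∷ -ᶻ (+ w) ∷ []) ∷ (-ᶻ (+ suc w) ∷ + w ∷ []) ∷ [])
  ; rows   = λ { zero → r₀ (+ w) ; (suc zero) → r₁ (+ w) }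
  ; cols   = λ { zero → r₂ (1ℤ +ᶻ + w) ; (suc zero) → r₃ (+ w) }
  ; ents   = select-↭ (signed (w ∷ suc w ∷ [])) (# 2 ∷ # 1 ∷ # 3 ∷ # 0 ∷ [])
  }
  where
  r₀ : ∀ w → (1ℤ +ᶻ w) +ᶻ (-ᶻ w +ᶻ 0ℤ) ≡ 1ℤ
  r₀ = ℤ-Solver.solve-∀
  r₁ : ∀ w → -ᶻ (1ℤ +ᶻ w) +ᶻ (w +ᶻ 0ℤ) ≡ -ᶻ 1ℤ
  r₁ = ℤ-Solver.solve-∀
  r₂ : ∀ w → w +ᶻ (-ᶻ w +ᶻ 0ℤ) ≡ 0ℤ
  r₂ = ℤ-Solver.solve-∀
  r₃ : ∀ w → -ᶻ w +ᶻ (w +ᶻ 0ℤ) ≡ 0ℤ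
  r₃ = ℤ-Solver.solve-∀

units : ∀ {h} (ws : Vec ℕ h) → Block 2 (h * 2) (± (+ h)) 0ℤ (signed (pairs ws))
units {zero} [] = record { matrix = λ _ () ; rows = λ { zero → refl ; (suc zero) → refl } ; cols = λ () ; ents = ↭-refl }
units {suc h} (w ∷ ws) = reblock (λ { zero → refl ; (suc zero) → neg-+ 1 h }) refl ↭-refl
  (hcat (unit-tile w) (units ws))

Triple : Set
Triple = ℕ × ℕ × ℕ

-- The row `x, y, -z` sums to `-h`, which `h` unit tiles make up for; together they have the width
-- `s = 3 + h * 2`, where `S = h + 1`.
Balanced : ℕ → Triple → Set
Balanced h (x , y , z) = z ≡ x + y + h

triple-tile : ∀ h x y → Block 2 3 (± (-ᶻ (+ h))) 0ℤ (signed (x ∷ y ∷ x + y + h ∷ []))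
triple-tile h x y = record
  { matrix = fromVec ((+ x ∷ + y ∷ -ᶻ (+ (x + y + h)) ∷ []) ∷ (-ᶻ (+ x) ∷ -ᶻ (+ y) ∷ + (x + y + h) ∷ []) ∷ [])
  ; rows   = λ { zero → r₀ (+ x) (+ y) (+ h) ; (suc zero) → r₁ (+ x) (+ y) (+ h) }
  ; cols   = λ { zero → c₀ (+ x) ; (suc zero) → c₀ (+ y) ; (suc (suc zero)) → c₁ (+ (x + y + h)) }
  ; ents   = select-↭ (signed (x ∷ y ∷ x + y + h ∷ [])) (# 0 ∷ # 2 ∷ # 5 ∷ # 1 ∷ # 3 ∷ # 4 ∷ [])
  }
  where
  r₀ : ∀ x y h → x +ᶻ (y +ᶻ (-ᶻ (x +ᶻ y +ᶻ h) +ᶻ 0ℤ)) ≡ -ᶻ h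
  r₀ = ℤ-Solver.solve-∀
  r₁ : ∀ x y h → -ᶻ x +ᶻ (-ᶻ y +ᶻ ((x +ᶻ y +ᶻ h) +ᶻ 0ℤ)) ≡ -ᶻ (-ᶻ h)
  r₁ = ℤ-Solver.solve-∀
  c₀ : ∀ w → w +ᶻ (-ᶻ w +ᶻ 0ℤ) ≡ 0ℤ
  c₀ = ℤ-Solver.solve-∀
  c₁ : ∀ w → -ᶻ w +ᶻ (w +ᶻ 0ℤ) ≡ 0ℤ
  c₁ = ℤ-Solver.solve-∀

flat : ∀ {n} → Vec Triple n → List ℕ
flat []                 = []
flat ((x , y , z) ∷ ts) = x ∷ y ∷ z ∷ flat ts

flat-++ : ∀ {m n} (ts : Vec Triple m) (us : Vec Triple n) → flat (ts Vec.++ us) ≡ flat ts ++ flat us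
flat-++ []                 us = refl
flat-++ ((x , y , z) ∷ ts) us = cong (λ xs → x ∷ y ∷ z ∷ xs) (flat-++ ts us)

opposite-rows : ∀ {r h m} → m ≡ r * h → (ts : Vec Triple r) → VAll (Balanced h) ts → (ws : Vec ℕ m) →
                Block (r * 2) (3 + h * 2) (const 0ℤ) 0ℤ (signed (flat ts ++ pairs ws))
opposite-rows refl [] [] [] = record { matrix = λ () ; rows = λ () ; cols = λ _ → refl ; ents = ↭-refl }
opposite-rows {suc r} {h} refl ((x , y , _) ∷ ts) (refl ∷ bal) ws with Vec.splitAt h ws
... | us , vs , refl = reblock (λ _ → refl) refl perm
    (vcat (reblock (λ { zero → ℤ.+-inverseˡ (+ h) ; (suc zero) → ℤ.+-inverseˡ (-ᶻ (+ h)) }) refl ↭-refl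
             (hcat (triple-tile h x y) (units us)))
          (opposite-rows refl ts bal vs))
  where
  open PermutationReasoning
  t = x ∷ y ∷ x + y + h ∷ []
  perm : (signed t ++ signed (pairs us)) ++ signed (flat ts ++ pairs vs) ↭ signed ((t ++ flat ts) ++ pairs (us Vec.++ vs))
  perm = begin
    (signed t ++ signed (pairs us)) ++ signed (flat ts ++ pairs vs) ≡⟨ cong (_++ signed (flat ts ++ pairs vs)) (signed-++ t _) ⟨
    signed (t ++ pairs us) ++ signed (flat ts ++ pairs vs) ≡⟨ signed-++ (t ++ pairs us) _ ⟨
    signed ((t ++ pairs us) ++ (flat ts ++ pairs vs)) ↭⟨ signed-↭ (interchange t (pairs us) {flat ts} {pairs vs}) ⟩
    signed ((t ++ flat ts) ++ (pairs us ++ pairs vs)) ≡⟨ cong (λ xs → signed ((t ++ flat ts) ++ xs)) (pairs-++ us vs) ⟨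
    signed ((t ++ flat ts) ++ pairs (us Vec.++ vs)) ∎

-- This leaves a partition problem for absolute values: the numbers up to half of one less than the
-- number of cells are to be split into `[1, S]`, `S` intervals of length `s`, `r` balanced triples
-- and `r * h` pairs of neighbours.
magic-from-rows : ∀ h r {m} → m ≡ r * h → (ls : Vec ℕ (suc h)) (ts : Vec Triple r) → VAll (Balanced h) ts → (ws : Vec ℕ m) →
  (rng 1 (suc h) ++ intervals (3 + h * 2) ls) ++ (flat ts ++ pairs ws) ↭ rng 1 (suc h + suc h * (3 + h * 2) + r * (3 + h * 2)) →
  Magic (3 + h * 2 + r * 2) (3 + h * 2)
magic-from-rows h r m≡ ls ts bal ws perm = signed⇒magic (suc h + suc h * (3 + h * 2) + r * (3 + h * 2)) (count h r)
  (reblock (λ _ → refl) refl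
    (prep 0ℤ (↭-trans (↭-reflexive (≡.sym (signed-++ (rng 1 (suc h) ++ intervals (3 + h * 2) ls) _))) (signed-↭ perm)))
    (vcat (Core.core (suc h) ls) (opposite-rows m≡ ts bal ws)))
  where
  count : ∀ h r → 1 + (suc h + suc h * (3 + h * 2) + r * (3 + h * 2)) * 2 ≡ (3 + h * 2 + r * 2) * (3 + h * 2)
  count = ℕ-Solver.solve-∀

-- Sporadic odd rectangles

decide-↭ : (xs ys : List ℕ) → {True (unique? _≟_ xs)} → {True (All.all? (_∈? ys) xs)} → {True (length ys ≤? length xs)} → xs ↭ ys
decide-↭ xs ys {u} {v} {w} = unique-⊆⇒↭ (toWitness u) (All.lookup (toWitness v)) (toWitness w)

-- This and the next two are the sizes with `h ≥ 1` and `R ≥ 2` pairs of opposite rows for which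
-- `(R - 1) * h < 3`, where `magic-nested` runs out of unit pairs.
magic-9×5 : Magic 9 5
magic-9×5 = magic-from-rows 1 2 refl (7 ∷ 13 ∷ []) ((3 , 18 , 22) ∷ (6 , 12 , 19) ∷ []) (refl ∷ refl ∷ []) (4 ∷ 20 ∷ []) (decide-↭ _ _)

magic-11×5 : Magic 11 5
magic-11×5 = magic-from-rows 1 3 refl (3 ∷ 14 ∷ []) ((8 , 10 , 19) ∷ (9 , 12 , 22) ∷ (11 , 13 , 25) ∷ []) (refl ∷ refl ∷ refl ∷ []) (20 ∷ 23 ∷ 26 ∷ []) (decide-↭ _ _)

magic-11×7 : Magic 11 7
magic-11×7 = magic-from-rows 2 2 refl (4 ∷ 16 ∷ 24 ∷ []) ((11 , 23 , 36) ∷ (14 , 15 , 31) ∷ []) (refl ∷ refl ∷ []) (12 ∷ 32 ∷ 34 ∷ 37 ∷ []) (decide-↭ _ _)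

-- Nested triples and the general layout

stride : ℕ → ℕ → List ℕ
stride x zero    = []
stride x (suc n) = n * 2 + x ∷ stride x n

stride-even : ∀ x n → stride x n ++ stride (suc x) n ↭ rng x (n * 2)
stride-even x zero    = ↭-refl
stride-even x (suc n) = begin
  n * 2 + x ∷ stride x n ++ (n * 2 + suc x ∷ stride (suc x) n) ↭⟨ prep _ (shift _ (stride x n) _) ⟩
  n * 2 + x ∷ n * 2 + suc x ∷ stride x n ++ stride (suc x) n   ↭⟨ ++⁺ˡ (n * 2 + x ∷ n * 2 + suc x ∷ []) (stride-even x n) ⟩
  n * 2 + x ∷ n * 2 + suc x ∷ rng x (n * 2)                    ↭⟨ ++-comm (n * 2 + x ∷ n * 2 + suc x ∷ []) (rng x (n * 2)) ⟩
  rng x (n * 2) ++ n * 2 + x ∷ n * 2 + suc x ∷ []              ≡⟨ cong (λ y → rng x (n * 2) ++ n * 2 + x ∷ y ∷ []) (+-suc (n * 2) x) ⟩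
  rng x (n * 2) ++ rng (n * 2 + x) 2                           ≡⟨ rng-++ x (n * 2) 2 ⟨
  rng x (n * 2 + 2)                                            ≡⟨ cong (rng x) (+-comm (n * 2) 2) ⟩
  rng x (2 + n * 2)                                            ∎
  where open PermutationReasoning

stride-odd : ∀ x n → stride x (suc n) ++ stride (suc x) n ↭ rng x (1 + n * 2)
stride-odd x n = begin
  n * 2 + x ∷ stride x n ++ stride (suc x) n  ↭⟨ prep _ (stride-even x n) ⟩
  n * 2 + x ∷ rng x (n * 2)                   ↭⟨ ∷↭∷ʳ (n * 2 + x) (rng x (n * 2)) ⟩
  rng x (n * 2) ++ [ n * 2 + x ]              ≡⟨ rng-∷ʳ x (n * 2) ⟨
  rng x (1 + n * 2)                           ∎
  where open PermutationReasoning

-- y and z run through n nested pairs around a gap of length w that starts at n + b.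
nest : ℕ → ℕ → ℕ → ∀ n → Vec Triple n
nest w x b zero    = []
nest w x b (suc n) = (n * 2 + x , b , n * 2 + w + suc b) ∷ nest w x (suc b) n

-- Going inwards, `z - y` and the first entry both drop by 2, so the equation for the innermost
-- triple suffices.
nest-balanced : ∀ h w x b n → x + h ≡ suc w → VAll (Balanced h) (nest w x b n)
nest-balanced h w x b zero    eq = []
nest-balanced h w x b (suc n) eq = bal ∷ nest-balanced h w x (suc b) n eq
  where
  open ≡.≡-Reasoning
  bal : n * 2 + w + suc b ≡ n * 2 + x + b + h
  bal = begin
    n * 2 + w + suc b    ≡⟨ lemma₁ n w b ⟩
    n * 2 + b + suc w    ≡⟨ cong (λ y → n * 2 + b + y) eq ⟨
    n * 2 + b + (x + h)  ≡⟨ lemma₂ n x b h ⟩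
    n * 2 + x + b + h    ∎
    where
    lemma₁ : ∀ n w b → n * 2 + w + suc b ≡ n * 2 + b + suc w
    lemma₁ = ℕ-Solver.solve-∀
    lemma₂ : ∀ n x b h → n * 2 + b + (x + h) ≡ n * 2 + x + b + h
    lemma₂ = ℕ-Solver.solve-∀

-- The `y`s and `z`s use up both ends of an interval of length `n * 2 + w` and leave its middle; the
-- `x`s form one parity class.
nest-↭ : ∀ w x b n → flat (nest w x b n) ++ rng (n + b) w ↭ stride x n ++ rng b (n * 2 + w)
nest-↭ w x b zero    = ↭-refl
nest-↭ w x b (suc n) = prep (n * 2 + x) (begin
  b ∷ z ∷ flat (nest w x (suc b) n) ++ rng (suc n + b) w   ≡⟨ cong (λ y → b ∷ z ∷ flat (nest w x (suc b) n) ++ rng y w) (+-suc n b) ⟨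
  b ∷ z ∷ flat (nest w x (suc b) n) ++ rng (n + suc b) w   ↭⟨ prep b (prep z (nest-↭ w x (suc b) n)) ⟩
  b ∷ z ∷ stride x n ++ rng (suc b) (n * 2 + w)            ↭⟨ shifts (b ∷ z ∷ []) (stride x n) ⟩
  stride x n ++ b ∷ z ∷ rng (suc b) (n * 2 + w)            ↭⟨ ++⁺ˡ (stride x n) (prep b (∷↭∷ʳ z (rng (suc b) (n * 2 + w)))) ⟩
  stride x n ++ b ∷ rng (suc b) (n * 2 + w) ++ [ z ]       ≡⟨ cong (λ zs → stride x n ++ b ∷ zs) (rng-∷ʳ (suc b) (n * 2 + w)) ⟨
  stride x n ++ rng b (2 + n * 2 + w)                      ∎)
  where
  open PermutationReasoning
  z = n * 2 + w + suc b

unitStarts : ℕ → ∀ n → Vec ℕ n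
unitStarts y zero    = []
unitStarts y (suc n) = y ∷ unitStarts (2 + y) n

pairs-unitStarts : ∀ y n → pairs (unitStarts y n) ≡ rng y (n * 2)
pairs-unitStarts y zero    = refl
pairs-unitStarts y (suc n) = cong (λ xs → y ∷ suc y ∷ xs) (pairs-unitStarts (2 + y) n)

consecutive : ℕ → ℕ → ∀ n → Vec ℕ n
consecutive w y zero    = []
consecutive w y (suc n) = y ∷ consecutive w (w + y) n

intervals-consecutive : ∀ w y n → intervals w (consecutive w y n) ≡ rng y (n * w)
intervals-consecutive w y zero    = refl
intervals-consecutive w y (suc n) = ≡.trans (cong (rng y w ++_) (intervals-consecutive w (w + y) n)) (≡.sym (rng-++ y w (n * w)))

-- The absolute values are laid out as follows (starts in brackets): the centre of the core,
-- one unit pair [p₁], the x's [p₂], nested pairs around the first core interval [p₃], nested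
-- pairs around H unit pairs [p₄], T unit pairs [p₅] and the other core intervals [p₆].
module Layout (h e o H T : ℕ) where

  s p₁ p₂ p₃ p₄ p₅ p₆ : ℕ
  s  = 3 + h * 2
  p₁ = suc h + 1
  -- The unit pair at `p₁` lifts the smallest `x` to `h + 4`, the value that balances a gap of
  -- length `s`: `(h + 4) + h ≡ s + 1`.
  p₂ = 2 + p₁
  p₃ = e + o + p₂
  p₄ = e * 2 + s + p₃
  p₅ = o * 2 + H * 2 + p₄
  p₆ = T * 2 + p₅

  ls : Vec ℕ (suc h)
  ls = e + p₃ ∷ consecutive s p₆ h

  ts : Vec Triple (e + o)
  ts = nest s p₂ p₃ e Vec.++ nest (H * 2) (suc p₂) p₄ o

  ws : Vec ℕ (1 + (H + T))
  ws = p₁ ∷ (unitStarts (o + p₄) H Vec.++ unitStarts p₅ T)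

  layout-↭ : stride p₂ e ++ stride (suc p₂) o ↭ rng p₂ (e + o) →
             (rng 1 (suc h) ++ intervals s ls) ++ (flat ts ++ pairs ws) ↭
             rng 1 (suc h + (2 + (e + o + (e * 2 + s + (o * 2 + H * 2 + (T * 2 + h * s))))))
  layout-↭ strides = begin
    (rng 1 (suc h) ++ intervals s ls) ++ (flat ts ++ pairs ws)
      ≡⟨ cong₂ _++_ (cong (λ xs → rng 1 (suc h) ++ rng (e + p₃) s ++ xs) (intervals-consecutive s p₆ h))
           (cong₂ _++_ (flat-++ (nest s p₂ p₃ e) _)
             (cong (rng p₁ 2 ++_) (≡.trans (pairs-++ (unitStarts (o + p₄) H) _)
               (cong₂ _++_ (pairs-unitStarts (o + p₄) H) (pairs-unitStarts p₅ T))))) ⟩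
    (rng 1 (suc h) ++ rng (e + p₃) s ++ rng p₆ (h * s)) ++
    ((flat (nest s p₂ p₃ e) ++ flat (nest (H * 2) (suc p₂) p₄ o)) ++ (rng p₁ 2 ++ rng (o + p₄) (H * 2) ++ rng p₅ (T * 2)))
      ↭⟨ solve 8 (λ a b c d f g i j → (a ⊕ b ⊕ c) ⊕ ((d ⊕ f) ⊕ (g ⊕ i ⊕ j)) ⊜ a ⊕ g ⊕ ((d ⊕ b) ⊕ (f ⊕ i)) ⊕ j ⊕ c) ↭-refl
           (rng 1 (suc h)) (rng (e + p₃) s) (rng p₆ (h * s)) (flat (nest s p₂ p₃ e)) (flat (nest (H * 2) (suc p₂) p₄ o)) (rng p₁ 2) (rng (o + p₄) (H * 2)) (rng p₅ (T * 2)) ⟩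
    rng 1 (suc h) ++ rng p₁ 2 ++ ((flat (nest s p₂ p₃ e) ++ rng (e + p₃) s) ++ (flat (nest (H * 2) (suc p₂) p₄ o) ++ rng (o + p₄) (H * 2))) ++ rng p₅ (T * 2) ++ rng p₆ (h * s)
      ↭⟨ ++⁺ˡ (rng 1 (suc h)) (++⁺ˡ (rng p₁ 2) (++⁺ʳ (rng p₅ (T * 2) ++ rng p₆ (h * s)) (++⁺ (nest-↭ s p₂ p₃ e) (nest-↭ (H * 2) (suc p₂) p₄ o)))) ⟩
    rng 1 (suc h) ++ rng p₁ 2 ++ ((stride p₂ e ++ rng p₃ (e * 2 + s)) ++ (stride (suc p₂) o ++ rng p₄ (o * 2 + H * 2))) ++ rng p₅ (T * 2) ++ rng p₆ (h * s)
      ↭⟨ ++⁺ˡ (rng 1 (suc h)) (++⁺ˡ (rng p₁ 2) (++⁺ʳ (rng p₅ (T * 2) ++ rng p₆ (h * s))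
           (↭-trans (interchange (stride p₂ e) (rng p₃ (e * 2 + s))) (++⁺ʳ _ strides)))) ⟩
    rng 1 (suc h) ++ rng p₁ 2 ++ (rng p₂ (e + o) ++ (rng p₃ (e * 2 + s) ++ rng p₄ (o * 2 + H * 2))) ++ rng p₅ (T * 2) ++ rng p₆ (h * s)
      ↭⟨ solve 7 (λ a b c d f g i → a ⊕ b ⊕ (c ⊕ (d ⊕ f)) ⊕ g ⊕ i ⊜ a ⊕ b ⊕ c ⊕ d ⊕ f ⊕ g ⊕ i) ↭-refl
           (rng 1 (suc h)) (rng p₁ 2) (rng p₂ (e + o)) (rng p₃ (e * 2 + s)) (rng p₄ (o * 2 + H * 2)) (rng p₅ (T * 2)) (rng p₆ (h * s)) ⟩
    rng 1 (suc h) ++ rng p₁ 2 ++ rng p₂ (e + o) ++ rng p₃ (e * 2 + s) ++ rng p₄ (o * 2 + H * 2) ++ rng p₅ (T * 2) ++ rng p₆ (h * s)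
      ≡⟨ join 1 (suc h) (join p₁ 2 (join p₂ (e + o) (join p₃ (e * 2 + s) (join p₄ (o * 2 + H * 2) (join p₅ (T * 2) refl))))) ⟩
    rng 1 (suc h + (2 + (e + o + (e * 2 + s + (o * 2 + H * 2 + (T * 2 + h * s)))))) ∎
    where
    open PermutationReasoning
    open ++-Solver
    join : ∀ x m {n xs} → xs ≡ rng (m + x) n → rng x m ++ xs ≡ rng x (m + n)
    join x m {n} refl = ≡.sym (rng-++ x m n)

  layout-magic : 1 + (H + T) ≡ (e + o) * h → stride p₂ e ++ stride (suc p₂) o ↭ rng p₂ (e + o) →
                 VAll (Balanced h) (nest (H * 2) (suc p₂) p₄ o) → Magic (3 + h * 2 + (e + o) * 2) (3 + h * 2)
  layout-magic count strides bal = magic-from-rows h (e + o) count ls ts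
    (VAll.++⁺ (nest-balanced h s p₂ p₃ e (lemma h)) bal) ws
    (↭-trans (layout-↭ strides) (↭-reflexive (cong (rng 1) total)))
    where
    open ≡.≡-Reasoning
    lemma : ∀ h → 2 + (suc h + 1) + h ≡ suc (3 + h * 2)
    lemma = ℕ-Solver.solve-∀
    lemma₁ : ∀ h e o H T s → suc h + (2 + (e + o + (e * 2 + s + (o * 2 + H * 2 + (T * 2 + h * s))))) ≡ suc h + suc h * s + (3 * (e + o) + (1 + (H + T)) * 2)
    lemma₁ = ℕ-Solver.solve-∀
    lemma₂ : ∀ r h → 3 * r + r * h * 2 ≡ r * (3 + h * 2)
    lemma₂ = ℕ-Solver.solve-∀
    total : suc h + (2 + (e + o + (e * 2 + s + (o * 2 + H * 2 + (T * 2 + h * s))))) ≡ suc h + suc h * s + (e + o) * s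
    total = begin
      suc h + (2 + (e + o + (e * 2 + s + (o * 2 + H * 2 + (T * 2 + h * s)))))  ≡⟨ lemma₁ h e o H T s ⟩
      suc h + suc h * s + (3 * (e + o) + (1 + (H + T)) * 2)                    ≡⟨ cong (λ n → suc h + suc h * s + (3 * (e + o) + n * 2)) count ⟩
      suc h + suc h * s + (3 * (e + o) + (e + o) * h * 2)                      ≡⟨ cong (λ n → suc h + suc h * s + n) (lemma₂ (e + o) h) ⟩
      suc h + suc h * s + (e + o) * s                                          ∎

split-strides : ∀ r → ∃[ e ] ∃[ o ] e + o ≡ r × (∀ x → stride x e ++ stride (suc x) o ↭ rng x (e + o))
split-strides r with parity r
... | inj₁ (o , refl) = o , o , lemma o , λ x → ↭-trans (stride-even x o) (↭-reflexive (cong (rng x) (≡.sym (lemma o))))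
  where
  lemma : ∀ o → o + o ≡ o * 2
  lemma = ℕ-Solver.solve-∀
... | inj₂ (o , refl) = suc o , o , lemma o , λ x → ↭-trans (stride-odd x o) (↭-reflexive (cong (rng x) (≡.sym (lemma o))))
  where
  lemma : ∀ o → suc o + o ≡ 1 + o * 2
  lemma = ℕ-Solver.solve-∀

-- The second nest starts at `x = h + 5`, which forces a gap of `2h + 4`, that is `2 + h` unit
-- pairs. One more sits at `p₁`, so `r * h - 3` of the `(r + 1) * h` unit pairs remain for `T`.
magic-nested : ∀ h r → 3 ≤ r * h → Magic (3 + h * 2 + suc r * 2) (3 + h * 2)
magic-nested h r 3≤rh with split-strides (suc r)
... | e , o , eq , strides = magic-≡ (cong (λ n → 3 + h * 2 + n * 2) eq) refl
    (layout-magic count (strides p₂) (nest-balanced h ((2 + h) * 2) (suc p₂) p₄ o (gap h)))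
  where
  t = r * h ∸ 3
  open Layout h e o (2 + h) t
  gap : ∀ h → suc (2 + (suc h + 1)) + h ≡ suc ((2 + h) * 2)
  gap = ℕ-Solver.solve-∀
  lemma : ∀ h t → 1 + (2 + h + t) ≡ h + (3 + t)
  lemma = ℕ-Solver.solve-∀
  count : 1 + (2 + h + t) ≡ (e + o) * h
  count = ≡.trans (≡.trans (lemma h t) (cong (λ n → h + n) (m+[n∸m]≡n 3≤rh))) (cong (_* h) (≡.sym eq))

magic-square : ∀ h → Magic (3 + h * 2) (3 + h * 2)
magic-square h = magic-≡ (+-identityʳ _) refl (magic-from-rows h 0 refl (consecutive (3 + h * 2) (suc h + 1) (suc h)) [] [] []
  (↭-reflexive (≡.trans (List.++-identityʳ _)
    (≡.trans (cong (rng 1 (suc h) ++_) (intervals-consecutive (3 + h * 2) (suc h + 1) (suc h)))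
      (≡.trans (≡.sym (rng-++ 1 (suc h) (suc h * (3 + h * 2)))) (cong (rng 1) (≡.sym (+-identityʳ _))))))))

magic-odd-≥5 : ∀ h r → Magic (5 + h * 2 + r * 2) (5 + h * 2)
magic-odd-≥5 h zero = magic-≡ (≡.sym (+-identityʳ _)) refl (magic-square (suc h))
-- A single triple around the first core interval; one unit pair at `p₁` and `h` others are the
-- `suc h` required.
magic-odd-≥5 h (suc zero) = layout-magic (cong suc (≡.sym (+-identityʳ h))) ↭-refl []
  where open Layout (suc h) 1 0 0 h
magic-odd-≥5 zero (suc (suc zero)) = magic-9×5
magic-odd-≥5 zero (suc (suc (suc zero))) = magic-11×5
magic-odd-≥5 zero (suc (suc (suc (suc r)))) = magic-nested 1 (3 + r) (s≤s (s≤s (s≤s z≤n)))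
magic-odd-≥5 (suc zero) (suc (suc zero)) = magic-11×7
magic-odd-≥5 (suc zero) (suc (suc (suc r))) = magic-nested 2 (2 + r) (s≤s (s≤s (s≤s z≤n)))
magic-odd-≥5 (suc (suc h)) (suc (suc r)) = magic-nested (3 + h) (1 + r) (s≤s (s≤s (s≤s z≤n)))

-- Odd rectangles with three rows

-- All tiles with three rows have row sums `k, 0, -k`, so only one number has to cancel over the
-- whole rectangle.
antisym : ℤ → Fin 3 → ℤ
antisym k zero             = k
antisym k (suc zero)       = 0ℤ
antisym k (suc (suc zero)) = -ᶻ k

infix 4 _∈±_
data _∈±_ : ℤ → ℕ → Set where
  pos : ∀ {x} → + x ∈± x
  neg : ∀ {x} → -ᶻ (+ x) ∈± x

∈±⇒↭ : ∀ {u x} → u ∈± x → u ∷ -ᶻ u ∷ [] ↭ signed [ x ]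
∈±⇒↭ pos     = ↭-refl
∈±⇒↭ {x = x} neg = ↭-trans (swap _ _ ↭-refl) (↭-reflexive (cong (λ y → y ∷ -ᶻ (+ x) ∷ []) (ℤ.neg-involutive (+ x))))

-- The second column is the first turned upside down and negated: the middle row cancels, the outer
-- rows get opposite sums, and both columns vanish by the one equation `u + w ≡ v`.
two-columns : ∀ {u v w x y z} → u +ᶻ w ≡ v → u ∈± x → v ∈± y → w ∈± z →
              Block 3 2 (antisym (u +ᶻ v)) 0ℤ (signed (x ∷ y ∷ z ∷ []))
two-columns {u} {v} {w} {x} {y} {z} refl u∈ v∈ w∈ = record
  { matrix = fromVec ((u ∷ v ∷ []) ∷ (w ∷ -ᶻ w ∷ []) ∷ (-ᶻ v ∷ -ᶻ u ∷ []) ∷ [])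
  ; rows   = λ { zero → r₀ u v ; (suc zero) → r₁ w ; (suc (suc zero)) → r₂ u v }
  ; cols   = λ { zero → c₀ u w ; (suc zero) → c₁ u w }
  ; ents   = ↭-trans (select-↭ (u ∷ -ᶻ u ∷ v ∷ -ᶻ v ∷ w ∷ -ᶻ w ∷ []) (# 0 ∷ # 2 ∷ # 4 ∷ # 5 ∷ # 3 ∷ # 1 ∷ []))
      (++⁺ (∈±⇒↭ u∈) (++⁺ (∈±⇒↭ v∈) (∈±⇒↭ w∈)))
  }
  where
  r₀ : ∀ u v → u +ᶻ (v +ᶻ 0ℤ) ≡ u +ᶻ v
  r₀ = ℤ-Solver.solve-∀
  r₁ : ∀ w → w +ᶻ (-ᶻ w +ᶻ 0ℤ) ≡ 0ℤ
  r₁ = ℤ-Solver.solve-∀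
  r₂ : ∀ u v → -ᶻ v +ᶻ (-ᶻ u +ᶻ 0ℤ) ≡ -ᶻ (u +ᶻ v)
  r₂ = ℤ-Solver.solve-∀
  c₀ : ∀ u w → u +ᶻ (w +ᶻ (-ᶻ (u +ᶻ w) +ᶻ 0ℤ)) ≡ 0ℤ
  c₀ = ℤ-Solver.solve-∀
  c₁ : ∀ u w → (u +ᶻ w) +ᶻ (-ᶻ w +ᶻ (-ᶻ u +ᶻ 0ℤ)) ≡ 0ℤ
  c₁ = ℤ-Solver.solve-∀

one-column : ∀ {u x} → u ∈± x → Block 3 1 (antisym u) 0ℤ (0ℤ ∷ signed [ x ])
one-column {u} u∈ = record
  { matrix = fromVec ((u ∷ []) ∷ (0ℤ ∷ []) ∷ (-ᶻ u ∷ []) ∷ [])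
  ; rows   = λ { zero → ℤ.+-identityʳ u ; (suc zero) → refl ; (suc (suc zero)) → ℤ.+-identityʳ (-ᶻ u) }
  ; cols   = λ { zero → c₀ u }
  ; ents   = ↭-trans (swap u 0ℤ ↭-refl) (prep 0ℤ (∈±⇒↭ u∈))
  }
  where
  c₀ : ∀ u → u +ᶻ (0ℤ +ᶻ (-ᶻ u +ᶻ 0ℤ)) ≡ 0ℤ
  c₀ = ℤ-Solver.solve-∀

-- Column pairs for x + y = z whose top row contains, up to sign, the two named entries.

yz⁺ : ∀ x y z → z ≡ x + y → Block 3 2 (antisym (+ y +ᶻ + z)) 0ℤ (signed (x ∷ y ∷ z ∷ []))
yz⁺ x y z refl = reblock (λ _ → refl) refl (signed-↭ (↭-sym (∷↭∷ʳ x (y ∷ z ∷ [])))) (two-columns (ℤ.+-comm (+ y) (+ x)) pos pos pos)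

yz⁻ : ∀ x y z → z ≡ x + y → Block 3 2 (antisym (-ᶻ (+ y) +ᶻ -ᶻ (+ z))) 0ℤ (signed (x ∷ y ∷ z ∷ []))
yz⁻ x y z refl = reblock (λ _ → refl) refl (signed-↭ (↭-sym (∷↭∷ʳ x (y ∷ z ∷ [])))) (two-columns (lemma (+ x) (+ y)) neg neg (neg {x}))
  where
  lemma : ∀ x y → -ᶻ y +ᶻ -ᶻ x ≡ -ᶻ (x +ᶻ y)
  lemma = ℤ-Solver.solve-∀

zx⁺ : ∀ x y z → z ≡ x + y → Block 3 2 (antisym (+ z +ᶻ + x)) 0ℤ (signed (x ∷ y ∷ z ∷ []))
zx⁺ x y z refl = reblock (λ _ → refl) refl (signed-↭ (∷↭∷ʳ z (x ∷ y ∷ []))) (two-columns (lemma (+ x) (+ y)) pos pos (neg {y}))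
  where
  lemma : ∀ x y → (x +ᶻ y) +ᶻ -ᶻ y ≡ x
  lemma = ℤ-Solver.solve-∀

zx⁻ : ∀ x y z → z ≡ x + y → Block 3 2 (antisym (-ᶻ (+ z) +ᶻ -ᶻ (+ x))) 0ℤ (signed (x ∷ y ∷ z ∷ []))
zx⁻ x y z refl = reblock (λ _ → refl) refl (signed-↭ (∷↭∷ʳ z (x ∷ y ∷ []))) (two-columns (lemma (+ x) (+ y)) (neg {z}) neg (pos {y}))
  where
  lemma : ∀ x y → -ᶻ (x +ᶻ y) +ᶻ y ≡ -ᶻ x
  lemma = ℤ-Solver.solve-∀

yx⁺ : ∀ x y z → z ≡ x + y → Block 3 2 (antisym (+ y +ᶻ -ᶻ (+ x))) 0ℤ (signed (x ∷ y ∷ z ∷ []))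
yx⁺ x y z refl = reblock (λ _ → refl) refl (signed-↭ (swap y x ↭-refl)) (two-columns (lemma (+ x) (+ y)) pos neg (neg {z}))
  where
  lemma : ∀ x y → y +ᶻ -ᶻ (x +ᶻ y) ≡ -ᶻ x
  lemma = ℤ-Solver.solve-∀

antisym-+ : ∀ {k l m} → k +ᶻ l ≡ m → ∀ i → antisym k i +ᶻ antisym l i ≡ antisym m i
antisym-+ {k} {l} refl zero             = refl
antisym-+ {k} {l} refl (suc zero)       = refl
antisym-+ {k} {l} refl (suc (suc zero)) = ≡.sym (ℤ.neg-distrib-+ k l)

infixr 5 _⟨_⟩_
_⟨_⟩_ : ∀ {b b′ k l m xs ys} → Block 3 b (antisym k) 0ℤ xs → k +ᶻ l ≡ m → Block 3 b′ (antisym l) 0ℤ ys →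
        Block 3 (b + b′) (antisym m) 0ℤ (xs ++ ys)
X ⟨ eq ⟩ Y = reblock (antisym-+ eq) refl ↭-refl (hcat X Y)

-- Along a nest `y + z` is constant, so the column pairs of two neighbouring triples, taken with
-- opposite signs, cancel. Two triples can thus be peeled off without changing `k`.
nested-columns : ∀ zs w b n {m k} →
  Block 3 m (antisym k) 0ℤ (zs ++ signed (flat (nest w (suc w) (2 + b) n) ++ rng (n + (2 + b)) w)) →
  Block 3 (4 + m) (antisym k) 0ℤ (zs ++ signed (flat (nest w (suc w) b (2 + n)) ++ rng (2 + n + b) w))
nested-columns zs w b n {m} {k} X = reblock (λ _ → refl) refl perm
  (_⟨_⟩_ {l = k} (yz⁺ _ _ _ (lemma₁ n w b) ⟨ lemma₃ (+ (n * 2 + w)) (+ b) ⟩ yz⁻ _ _ _ (lemma₂ n w b)) (ℤ.+-identityˡ k) X)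
  where
  lemma₁ : ∀ n w b → 2 + n * 2 + w + suc b ≡ 2 + n * 2 + suc w + b
  lemma₁ = ℕ-Solver.solve-∀
  lemma₂ : ∀ n w b → n * 2 + w + suc (suc b) ≡ n * 2 + suc w + suc b
  lemma₂ = ℕ-Solver.solve-∀
  lemma₃ : ∀ v b → (b +ᶻ ((+ 2 +ᶻ v) +ᶻ (+ 1 +ᶻ b))) +ᶻ (-ᶻ (+ 1 +ᶻ b) +ᶻ -ᶻ (v +ᶻ (+ 2 +ᶻ b))) ≡ 0ℤ
  lemma₃ = ℤ-Solver.solve-∀
  open PermutationReasoning
  ts = flat (nest w (suc w) b (2 + n))
  t₁t₂ = take 6 ts
  rest = flat (nest w (suc w) (2 + b) n)
  perm : signed t₁t₂ ++ (zs ++ signed (rest ++ rng (n + (2 + b)) w)) ↭ zs ++ signed (ts ++ rng (2 + n + b) w)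
  perm = begin
    signed t₁t₂ ++ (zs ++ signed (rest ++ rng (n + (2 + b)) w))  ↭⟨ shifts (signed t₁t₂) zs ⟩
    zs ++ signed t₁t₂ ++ signed (rest ++ rng (n + (2 + b)) w)    ≡⟨ cong (zs ++_) (signed-++ t₁t₂ (rest ++ rng (n + (2 + b)) w)) ⟨
    zs ++ signed (ts ++ rng (n + (2 + b)) w)                     ≡⟨ cong (λ y → zs ++ signed (ts ++ rng y w)) (≡.trans (+-suc n (suc b)) (cong suc (+-suc n b))) ⟩
    zs ++ signed (ts ++ rng (2 + n + b) w)                       ∎

-- The one-point gap of this nest shares its column with the entry 0. The excess `-3` is reached in
-- both base cases and kept by `nested-columns`; it is opposite to that of `odd-columns`.
even-columns : ∀ n b → Block 3 (3 + n * 2) (antisym (-ᶻ (+ 3))) 0ℤ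
  (0ℤ ∷ signed (flat (nest 1 2 b (1 + n)) ++ rng (1 + n + b) 1))
even-columns zero b = reblock (λ _ → refl) refl (prep 0ℤ (signed-↭ (∷↭∷ʳ (1 + b) (2 ∷ b ∷ 2 + b ∷ []))))
  (one-column (pos {1 + b}) ⟨ lemma (+ b) ⟩ zx⁻ 2 b (2 + b) refl)
  where
  lemma : ∀ b → (+ 1 +ᶻ b) +ᶻ (-ᶻ (+ 2 +ᶻ b) +ᶻ -ᶻ (+ 2)) ≡ -ᶻ (+ 3)
  lemma = ℤ-Solver.solve-∀
even-columns (suc zero) b = reblock (λ _ → refl) refl
  (prep 0ℤ (signed-↭ (↭-trans (∷↭∷ʳ (2 + b) (2 ∷ 1 + b ∷ 3 + b ∷ 4 ∷ b ∷ 4 + b ∷ []))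
    (++⁺ʳ [ 2 + b ] (++-comm (2 ∷ 1 + b ∷ 3 + b ∷ []) (4 ∷ b ∷ 4 + b ∷ []))))))
  (one-column (neg {2 + b}) ⟨ lemma (+ b) ⟩ (zx⁻ 2 (1 + b) (3 + b) refl ⟨ refl ⟩ yz⁺ 4 b (4 + b) refl))
  where
  lemma : ∀ b → -ᶻ (+ 2 +ᶻ b) +ᶻ ((-ᶻ (+ 3 +ᶻ b) +ᶻ -ᶻ (+ 2)) +ᶻ (b +ᶻ (+ 4 +ᶻ b))) ≡ -ᶻ (+ 3)
  lemma = ℤ-Solver.solve-∀
even-columns (suc (suc n)) b = nested-columns [ 0ℤ ] 1 b (1 + n) (even-columns n (2 + b))

odd-columns : ∀ n b → Block 3 (4 + n * 2) (antisym (+ 3)) 0ℤ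
  (signed (flat (nest 0 1 b (2 + n)) ++ rng (2 + n + b) 0))
odd-columns zero b = zx⁺ 3 b (3 + b) refl ⟨ lemma (+ b) ⟩ zx⁻ 1 (1 + b) (2 + b) refl
  where
  lemma : ∀ b → ((+ 3 +ᶻ b) +ᶻ + 3) +ᶻ (-ᶻ (+ 2 +ᶻ b) +ᶻ -ᶻ (+ 1)) ≡ + 3
  lemma = ℤ-Solver.solve-∀
odd-columns (suc zero) b = yz⁻ 5 b (5 + b) refl ⟨ lemma (+ b) ⟩ (zx⁺ 3 (1 + b) (4 + b) refl ⟨ refl ⟩ yx⁺ 1 (2 + b) (3 + b) refl)
  where
  lemma : ∀ b → (-ᶻ b +ᶻ -ᶻ (+ 5 +ᶻ b)) +ᶻ (((+ 4 +ᶻ b) +ᶻ + 3) +ᶻ ((+ 2 +ᶻ b) +ᶻ -ᶻ (+ 1))) ≡ + 3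
  lemma = ℤ-Solver.solve-∀
odd-columns (suc (suc n)) b = nested-columns [] 0 b (2 + n) (odd-columns n (2 + b))

-- For `z ≡ x + y`, odd `x`s nest around nothing and even `x`s around a single point, the one
-- missing from the partition. The `x`s come lowest, followed by the interval of the even nest and
-- that of the odd nest.
magic-3×columns : ∀ m n → stride 1 (2 + n) ++ stride 2 (1 + m) ↭ rng 1 (2 + n + (1 + m)) →
                  Magic 3 ((3 + m * 2) + (4 + n * 2))
magic-3×columns m n strides = signed⇒magic (e + o + (o * 2 + 1 + (e * 2 + 0))) (count m n)
  (reblock (λ { zero → refl ; (suc zero) → refl ; (suc (suc zero)) → refl }) refl (prep 0ℤ perm)
    (hcat (even-columns m b₁) (odd-columns n b₂)))
  where
  e = 2 + n
  o = 1 + m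
  b₁ = e + o + 1
  b₂ = o * 2 + 1 + b₁
  count : ∀ m n → 1 + (2 + n + (1 + m) + ((1 + m) * 2 + 1 + ((2 + n) * 2 + 0))) * 2 ≡ 3 * ((3 + m * 2) + (4 + n * 2))
  count = ℕ-Solver.solve-∀
  even = flat (nest 1 2 b₁ o) ++ rng (o + b₁) 1
  odd  = flat (nest 0 1 b₂ e) ++ rng (e + b₂) 0
  open PermutationReasoning
  perm : signed even ++ signed odd ↭ signed (rng 1 (e + o + (o * 2 + 1 + (e * 2 + 0))))
  perm = begin
    signed even ++ signed odd   ≡⟨ signed-++ even odd ⟨
    signed (even ++ odd)        ↭⟨ signed-↭ (begin
      even ++ odd ↭⟨ ++⁺ (nest-↭ 1 2 b₁ o) (nest-↭ 0 1 b₂ e) ⟩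
      (stride 2 o ++ rng b₁ (o * 2 + 1)) ++ (stride 1 e ++ rng b₂ (e * 2 + 0)) ↭⟨ interchange (stride 2 o) (rng b₁ (o * 2 + 1)) ⟩
      (stride 2 o ++ stride 1 e) ++ (rng b₁ (o * 2 + 1) ++ rng b₂ (e * 2 + 0)) ↭⟨ ++⁺ (↭-trans (++-comm (stride 2 o) (stride 1 e)) strides) (↭-reflexive (≡.sym (rng-++ b₁ (o * 2 + 1) (e * 2 + 0)))) ⟩
      rng 1 (e + o) ++ rng b₁ (o * 2 + 1 + (e * 2 + 0)) ≡⟨ rng-++ 1 (e + o) _ ⟨
      rng 1 (e + o + (o * 2 + 1 + (e * 2 + 0))) ∎) ⟩
    signed (rng 1 (e + o + (o * 2 + 1 + (e * 2 + 0)))) ∎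

-- `magic-3×columns` starts at width 7, so this width is given by a table.
magic-3×5 : Magic 3 5
magic-3×5 = signed⇒magic 7 refl (record
  { matrix = fromVec
      ( (+ 7         ∷ -ᶻ (+ 5) ∷ -ᶻ (+ 7) ∷ + 0         ∷ + 5        ∷ [])
      ∷ (-ᶻ (+ 1)    ∷ + 2      ∷ + 6      ∷ -ᶻ (+ 4)    ∷ -ᶻ (+ 3)   ∷ [])
      ∷ (-ᶻ (+ 6)    ∷ + 3      ∷ + 1      ∷ + 4         ∷ -ᶻ (+ 2)   ∷ []) ∷ [])
  ; rows = λ { zero → refl ; (suc zero) → refl ; (suc (suc zero)) → refl }
  ; cols = λ { zero → refl ; (suc zero) → refl ; (suc (suc zero)) → refl ; (suc (suc (suc zero))) → refl ; (suc (suc (suc (suc zero)))) → refl }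
  ; ents = select-↭ (0ℤ ∷ signed (rng 1 7))
      (# 13 ∷ # 10 ∷ # 14 ∷ # 0 ∷ # 9 ∷ # 2 ∷ # 3 ∷ # 11 ∷ # 8 ∷ # 6 ∷ # 12 ∷ # 5 ∷ # 1 ∷ # 7 ∷ # 4 ∷ [])
  })

magic-3× : ∀ r → Magic 3 (3 + r * 2)
magic-3× zero       = magic-square 0
magic-3× (suc zero) = magic-3×5
magic-3× (suc (suc r)) with parity r
... | inj₁ (j , refl) = magic-≡ refl (width j) (magic-3×columns j j (↭-trans (stride-odd 1 (1 + j)) (↭-reflexive (cong (rng 1) (lemma j)))))
  where
  lemma : ∀ j → 1 + (1 + j) * 2 ≡ 2 + j + (1 + j)
  lemma = ℕ-Solver.solve-∀
  width : ∀ j → (3 + j * 2) + (4 + j * 2) ≡ 7 + j * 2 * 2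
  width = ℕ-Solver.solve-∀
... | inj₂ (j , refl) = magic-≡ refl (width j) (magic-3×columns (1 + j) j (↭-trans (stride-even 1 (2 + j)) (↭-reflexive (cong (rng 1) (lemma j)))))
  where
  lemma : ∀ j → (2 + j) * 2 ≡ 2 + j + (2 + j)
  lemma = ℕ-Solver.solve-∀
  width : ∀ j → (3 + (1 + j) * 2) + (4 + j * 2) ≡ 9 + j * 2 * 2
  width = ℕ-Solver.solve-∀

magic-odd : ∀ S r → 1 ≤ S → Magic (1 + S * 2 + r * 2) (1 + S * 2)
magic-odd (suc zero)    r _ = Magic-flip (magic-3× r)
magic-odd (suc (suc h)) r _ = magic-odd-≥5 h r

-- Iterated joins and the theorem

iterOrder-≡ : ∀ n s k → iterOrder n s k ≡ n + k * s
iterOrder-≡ n s zero    = ≡.sym (+-identityʳ n)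
iterOrder-≡ n s (suc k) = ≡.trans (cong (_+ s) (iterOrder-≡ n s k)) (lemma n s k)
  where
  lemma : ∀ n s k → n + k * s + s ≡ n + (s + k * s)
  lemma = ℕ-Solver.solve-∀

module Iterate {n d s : ℕ} (G : Graph n) (reg : Regular d G) (d+s≡n : d + s ≡ n) (1≤d : 1 ≤ d) (2≤s : 2 ≤ s) where

  G⟨_⟩ : (k : ℕ) → Graph (iterOrder n s k)
  G⟨ k ⟩ = iterJoin s G k

  1≤s : 1 ≤ s
  1≤s = <⇒≤ 2≤s

  order-≡ : ∀ k → d + k * s + s ≡ iterOrder n s k
  order-≡ k = ≡.trans (lemma d s k) (≡.trans (cong (_+ k * s) d+s≡n) (≡.sym (iterOrder-≡ n s k)))
    where
    lemma : ∀ d s k → d + k * s + s ≡ d + s + k * s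
    lemma = ℕ-Solver.solve-∀

  regular : ∀ k → Regular (d + k * s) G⟨ k ⟩
  regular zero    u = ≡.trans (reg u) (≡.sym (+-identityʳ d))
  regular (suc k) u = ≡.trans (Join.join-regular G⟨ k ⟩ s (order-≡ k) (regular k) u) (lemma d s k)
    where
    lemma : ∀ d s k → d + k * s + s ≡ d + (s + k * s)
    lemma = ℕ-Solver.solve-∀

  needs : ∀ {c} → NeedsColours G c → ∀ k → NeedsColours G⟨ k ⟩ (k + c)
  needs p zero    = p
  needs p (suc k) = join-needs G⟨ k ⟩ 1≤s (needs p k)

  module Step (k : ℕ) {c : ℕ} (C : Coloured G⟨ k ⟩ c) =
    Steps G⟨ k ⟩ (regular k) (order-≡ k) (≤-trans 1≤d (m≤m+n d (k * s))) 1≤s C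

  -- For even `s` every order is even, and half of it, `r + k * b + b`, exceeds `b` because `1 ≤ r`;
  -- a rectangle exists at every step.
  coloured-even : ∀ r b → d ≡ r * 2 → s ≡ b * 2 → ∀ {c} → Coloured G c → ∀ k → Coloured G⟨ k ⟩ (k + c)
  coloured-even r b d≡ s≡ C zero    = C
  coloured-even r b d≡ s≡ C (suc k) = Step.join-one k (coloured-even r b d≡ s≡ C k)
    (magic-≡ order (≡.sym s≡) (magic-even (r + k * b + b) b (1≤b s≡) (m<n+m b (≤-trans (1≤r d≡) (m≤m+n r (k * b))))))
    where
    1≤b : ∀ {b} → s ≡ b * 2 → 1 ≤ b
    1≤b {zero}  eq = contradiction (subst (2 ≤_) eq 2≤s) λ ()
    1≤b {suc b} _  = s≤s z≤n
    1≤r : ∀ {r} → d ≡ r * 2 → 1 ≤ r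
    1≤r {zero}  eq = contradiction (subst (1 ≤_) eq 1≤d) λ ()
    1≤r {suc r} _  = s≤s z≤n
    lemma : ∀ r b k → (r + k * b + b) * 2 ≡ r * 2 + k * (b * 2) + b * 2
    lemma = ℕ-Solver.solve-∀
    order : (r + k * b + b) * 2 ≡ iterOrder n s k
    order = ≡.trans (lemma r b k) (≡.trans (cong₂ (λ d s → d + k * s + s) (≡.sym d≡) (≡.sym s≡)) (order-≡ k))

  -- For odd s only the graphs G⟨ k ⟩ with k even have odd order, hence a magic rectangle;
  -- from these the next two joins are labelled.
  module Odd (r S : ℕ) (d≡ : d ≡ r * 2) (s≡ : s ≡ 1 + S * 2) where

    1≤S : ∀ {S} → s ≡ 1 + S * 2 → 1 ≤ S
    1≤S {zero}  eq = contradiction (subst (2 ≤_) eq 2≤s) λ { (s≤s ()) }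
    1≤S {suc S} _  = s≤s z≤n

    rectangle : ∀ k → Magic (iterOrder n s (k * 2)) s
    rectangle k = magic-≡ order (≡.sym s≡) (magic-odd S (r + k * s) (1≤S s≡))
      where
      lemma : ∀ r s k → s + (r + k * s) * 2 ≡ r * 2 + k * 2 * s + s
      lemma = ℕ-Solver.solve-∀
      order : 1 + S * 2 + (r + k * s) * 2 ≡ iterOrder n s (k * 2)
      order = ≡.trans (cong (_+ (r + k * s) * 2) (≡.sym s≡)) (≡.trans (lemma r s k)
        (≡.trans (cong (λ d → d + k * 2 * s + s) (≡.sym d≡)) (order-≡ (k * 2))))

    square : Magic s s
    square = magic-≡ (≡.trans (+-identityʳ _) (≡.sym s≡)) (≡.sym s≡) (magic-odd S 0 (1≤S s≡))

    coloured-2* : ∀ {c} → Coloured G c → ∀ k → Coloured G⟨ k * 2 ⟩ (k * 2 + c)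
    coloured-2* C zero    = C
    coloured-2* C (suc k) = Step.join-two (k * 2) (coloured-2* C k) (rectangle k) square

    coloured-odd : ∀ {c} → Coloured G c → ∀ k → Coloured G⟨ k ⟩ (k + c)
    coloured-odd C k with parity k
    ... | inj₁ (m , refl) = coloured-2* C m
    ... | inj₂ (m , refl) = Step.join-one (m * 2) (coloured-2* C m) (rectangle m)

  coloured-iterate : ∀ r → d ≡ r * 2 → ∀ {c} → Coloured G c → ∀ k → Coloured G⟨ k ⟩ (k + c)
  coloured-iterate r d≡ with parity s
  ... | inj₁ (b , s≡) = coloured-even r b d≡ s≡
  ... | inj₂ (S , s≡) = Odd.coloured-odd r S d≡ s≡

theorem3p5 : ∀ (p r : ℕ) (G : Graph p) → 1 ≤ r → 3 ≤ p → 2 ≤ p ∸ 2 * r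
    → Regular (2 * r) G
    → (c : ℕ) → IsChromaticNumber G c → IsLocalAntimagicChromaticNumber G c
    → (∀ (k : ℕ) →
    (iterOrder p (p ∸ 2 * r) (suc k) ≡ p + suc k * (p ∸ 2 * r))
    × Regular (2 * r + suc k * (p ∸ 2 * r)) (iterJoin (p ∸ 2 * r) G (suc k)))
    × (∀ (k : ℕ) → IsLocalAntimagicChromaticNumber (iterJoin (p ∸ 2 * r) G k) (c + k))
theorem3p5 p r G 1≤r 3≤p 2≤s reg c (_ , χ-min) χla =
  (λ k → iterOrder-≡ p s (suc k) , regular (suc k)) ,
  (λ k → subst (IsLocalAntimagicChromaticNumber G⟨ k ⟩) (+-comm k c)
    (coloured⇒χla G⟨ k ⟩ (coloured-iterate r (*-comm 2 r) (χla⇒coloured G χla) k) (needs χ-min k)))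
  where
  s : ℕ
  s = p ∸ 2 * r
  -- Subtraction is truncated: it is `2 ≤ s` that yields this bound, and with it `2 * r + s ≡ p`.
  2r≤p : 2 * r ≤ p
  2r≤p = <⇒≤ (m∸n≢0⇒n<m (λ eq → contradiction (subst (2 ≤_) eq 2≤s) λ ()))
  open Iterate {s = s} G reg (m+[n∸m]≡n 2r≤p) (≤-trans 1≤r (m≤n*m r 2)) 2≤s
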